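{- For every integer $k\ge 1$, the odd cycle $C_{2k+1}$ satisfies $$\delta_{\mathrm{VC}}(C_{2k+1})=\frac{1}{2k+1}.$$
   Context: All graphs are finite and simple. $C_{2k+1}$ is the cycle on $2k+1$ vertices. A graph is $H$-free if it contains no (not necessarily induced) subgraph isomorphic to $H$; it is maximal $H$-free if it is $H$-free and adding any missing edge creates a copy of $H$. $\delta(G)$ denotes minimum degree. The VC-dimension $\mathrm{VC}(G)$ of a graph $G$ is the VC-dimension of the set system $\{N_G(v):v\in V(G)\}$ on $V(G)$, i.e. the maximum size of a set $S\subseteq V(G)$ such that $\{N_G(v)\cap S: v\in V(G)\}=2^S$. The VC-dimension threshold $\delta_{\mathrm{VC}}(H)$ is the infimum of all $\gamma\ge 0$ for which there exists a constant $C=C(\gamma,H)$ such that every maximal $H$-free graph $G$ with $\delta(G)\ge\gamma|V(G)|$ satisfies $\mathrm{VC}(G)\le C$. -}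

module Defs where

open import Data.Bool.Base using (Bool; false; T; _∧_; _∨_)
open import Data.Bool.Properties using (∨-comm; ∧-comm) renaming (_≟_ to _≟ᵇ_)
open import Data.Fin.Base using (Fin; zero; toℕ)
open import Data.Fin.Properties using (_≟_; any?; toℕ<n)
open import Data.Fin.Subset using (Subset; _∩_; _⊆_; ∣_∣; inside; outside)
open import Data.Fin.Subset.Properties using (_⊆?_; anySubset?)
open import Data.Integer.Base using (+_)
open import Data.List.Base using (List; []; _∷_; _++_; map; filter; allFin)
open import Data.List.Extrema.Nat using (min; max)
open import Data.Nat.Base using (ℕ; zero; suc; _+_; _*_; _≤_; _<_; s≤s; NonZero)
open import Data.Nat.DivMod using (_%_; m<n⇒m%n≡m; n%n≡0)
import Data.Nat.Properties as ℕ
open import Data.Product.Base using (Σ; ∃; _×_; _,_)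
open import Data.Rational.Base as ℚ using (ℚ; _/_; 0ℚ; 1ℚ)
import Data.Rational.Properties as ℚ
open import Data.Sum.Base using (_⊎_; inj₁; inj₂)
open import Data.Vec.Base as Vec using (tabulate)
open import Data.Vec.Properties using (≡-dec)
open import Function.Base using (_∘_)
open import Function.Bundles using (_⇔_; mk⇔)
open import Function.Definitions using (Injective)
open import Relation.Binary.PropositionalEquality using (_≡_; _≢_; refl; sym; trans; cong₂)
open import Relation.Nullary using (¬_; Dec; yes; no; does; contradiction)
open import Relation.Nullary.Decidable using (map′; ¬?; _→-dec_; decidable-stable; dec-false)

-- Two-sided, located Dedekind cuts.
record ℝ : Set₁ where
  field
    L : ℚ → Set    -- L q means q < x
    U : ℚ → Set    -- U q means x < q
    L-inhabited : ∃ L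
    U-inhabited : ∃ U
    L-rounded   : ∀ q → L q ⇔ (∃ λ r → q ℚ.< r × L r)
    U-rounded   : ∀ r → U r ⇔ (∃ λ q → q ℚ.< r × U q)
    disjoint    : ∀ q → ¬ (L q × U q)
    located     : ∀ q r → q ℚ.< r → L q ⊎ U r

open ℝ

infix 4 _≤ᴿ_

_≤ᴿ_ : ℝ → ℝ → Set
x ≤ᴿ y = ∀ q → L x q → L y q

fromℚ : ℚ → ℝ
fromℚ p = record
  { L = ℚ._< p
  ; U = p ℚ.<_
  ; L-inhabited = p ℚ.- 1ℚ , p-1<p
  ; U-inhabited = p ℚ.+ 1ℚ , p<p+1
  ; L-rounded = λ q → mk⇔ ℚ.<-dense (λ (r , q<r , r<p) → ℚ.<-trans q<r r<p)
  ; U-rounded = λ r → mk⇔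
      (λ p<r → let (q , p<q , q<r) = ℚ.<-dense p<r in q , q<r , p<q)
      (λ (q , q<r , p<q) → ℚ.<-trans p<q q<r)
  ; disjoint = λ q (q<p , p<q) → ℚ.<-asym q<p p<q
  ; located = loc
  }
  where
  p-1<p : p ℚ.- 1ℚ ℚ.< p
  p-1<p = ℚ.<-respʳ-≡ (ℚ.+-identityʳ p) (ℚ.+-monoʳ-< p (ℚ.negative⁻¹ (ℚ.- 1ℚ)))

  p<p+1 : p ℚ.< p ℚ.+ 1ℚ
  p<p+1 = ℚ.<-respˡ-≡ (ℚ.+-identityʳ p) (ℚ.+-monoʳ-< p (ℚ.positive⁻¹ 1ℚ))

  loc : ∀ q r → q ℚ.< r → (q ℚ.< p) ⊎ (p ℚ.< r)
  loc q r q<r with q ℚ.<? p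
  ... | yes q<p = inj₁ q<p
  ... | no  q≮p = inj₂ (ℚ.≤-<-trans (ℚ.≮⇒≥ q≮p) q<r)

IsInfimum : (ℝ → Set) → ℝ → Set₁
IsInfimum P x = (∀ y → P y → x ≤ᴿ y)
              × (∀ z → (∀ y → P y → z ≤ᴿ y) → z ≤ᴿ x)

record Graph (n : ℕ) : Set where
  field
    adj        : Fin n → Fin n → Bool
    adj-sym    : ∀ u v → adj u v ≡ adj v u
    adj-irrefl : ∀ v → adj v v ≡ false

  Adj : Fin n → Fin n → Set
  Adj u v = T (adj u v)

open Graph

neighbourhood : ∀ {n} → Graph n → Fin n → Subset n
neighbourhood G v = tabulate (adj G v)

degree : ∀ {n} → Graph n → Fin n → ℕ
degree G v = ∣ neighbourhood G v ∣

-- min also includes its first argument, here one of the degrees.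
minDegree : ∀ {n} → Graph (suc n) → ℕ
minDegree {n} G = min (degree G zero) (map (degree G) (allFin (suc n)))

-- Not necessarily induced copies.
Contains : ∀ {m n} → Graph m → Graph n → Set
Contains {m} {n} H G =
  Σ (Fin m → Fin n) λ f →
    Injective _≡_ _≡_ f × (∀ u v → Adj H u v → Adj G (f u) (f v))

Free : ∀ {m n} → Graph m → Graph n → Set
Free H G = ¬ Contains H G

addEdge : ∀ {n} → Graph n → (x y : Fin n) → x ≢ y → Graph n
addEdge {n} G x y x≢y = record
  { adj        = λ u v → adj G u v ∨ joins u v
  ; adj-sym    = λ u v → cong₂ _∨_ (adj-sym G u v) (joins-sym u v)
  ; adj-irrefl = λ v → cong₂ _∨_ (adj-irrefl G v) (joins-irrefl v)
  }
  where
  joins : Fin n → Fin n → Bool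
  joins u v = (does (u ≟ x) ∧ does (v ≟ y)) ∨ (does (u ≟ y) ∧ does (v ≟ x))

  joins-sym : ∀ u v → joins u v ≡ joins v u
  joins-sym u v = trans
    (∨-comm (does (u ≟ x) ∧ does (v ≟ y)) _)
    (cong₂ _∨_ (∧-comm (does (u ≟ y)) _) (∧-comm (does (u ≟ x)) _))

  joins-irrefl : ∀ v → joins v v ≡ false
  joins-irrefl v with v ≟ x | v ≟ y
  ... | yes v≡x | yes v≡y = contradiction (trans (sym v≡x) v≡y) x≢y
  ... | yes _   | no  _   = refl
  ... | no  _   | yes _   = refl
  ... | no  _   | no  _   = refl

MaximalFree : ∀ {m n} → Graph m → Graph n → Set
MaximalFree H G =
  Free H G × (∀ x y (x≢y : x ≢ y) → ¬ Adj G x y → Contains H (addEdge G x y x≢y))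

cycle : (m : ℕ) .{{_ : NonZero m}} → 3 ≤ m → Graph m
cycle m 3≤m = record
  { adj        = λ i j → next i j ∨ next j i
  ; adj-sym    = λ i j → ∨-comm (next i j) (next j i)
  ; adj-irrefl = λ i → cong₂ _∨_ (next-irrefl i) (next-irrefl i)
  }
  where
  next : Fin m → Fin m → Bool
  next i j = does (suc (toℕ i) % m ℕ.≟ toℕ j)

  1+i%m≢i : ∀ i → i < m → suc i % m ≢ i
  1+i%m≢i i i<m eq with ℕ.m≤n⇒m<n∨m≡n i<m
  ... | inj₁ 1+i<m = ℕ.1+n≢n (trans (sym (m<n⇒m%n≡m 1+i<m)) eq)
  ... | inj₂ refl with trans (sym (n%n≡0 m)) eq
  ...   | refl = contradiction 3≤m λ { (s≤s ()) }

  next-irrefl : ∀ i → next i i ≡ false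
  next-irrefl i = dec-false (suc (toℕ i) % m ℕ.≟ toℕ i) (1+i%m≢i (toℕ i) (toℕ<n i))

oddCycle : (k : ℕ) → 1 ≤ k → Graph (1 + 2 * k)
oddCycle k 1≤k = cycle (1 + 2 * k) (s≤s (ℕ.*-monoʳ-≤ 2 1≤k))

-- N(v) ∩ S ⊆ S always holds, so this says { N(v) ∩ S : v } = 2^S.
Shattered : ∀ {n} → Graph n → Subset n → Set
Shattered G S = ∀ A → A ⊆ S → ∃ λ v → neighbourhood G v ∩ S ≡ A

shattered? : ∀ {n} (G : Graph n) (S : Subset n) → Dec (Shattered G S)
shattered? {n} G S = map′
  (λ none A → decidable-stable (traced? A) (λ ¬t → none (A , ¬t)))
  (λ all (A , ¬t) → ¬t (all A))
  (¬? (anySubset? (¬? ∘ traced?)))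
  where
  traced? : (A : Subset n) → Dec (A ⊆ S → ∃ λ v → neighbourhood G v ∩ S ≡ A)
  traced? A = (A ⊆? S) →-dec any? (λ v → ≡-dec _≟ᵇ_ (neighbourhood G v ∩ S) A)

allSubsets : ∀ n → List (Subset n)
allSubsets zero    = Vec.[] ∷ []
allSubsets (suc n) =
  map (inside Vec.∷_) (allSubsets n) ++ map (outside Vec.∷_) (allSubsets n)

vcDim : ∀ {n} → Graph n → ℕ
vcDim {n} G = max 0 (map ∣_∣ (filter (shattered? G) (allSubsets n)))

-- Graphs are nonempty, so δ(G) ≥ γ|V(G)| is written γ ≤ δ(G)/|V(G)|.
BoundsVC : ∀ {m} → Graph m → ℝ → Set
BoundsVC H γ =
  fromℚ 0ℚ ≤ᴿ γ ×
  ∃ λ C → ∀ n (G : Graph (suc n)) → MaximalFree H G →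
    γ ≤ᴿ fromℚ (+ minDegree G / suc n) → vcDim G ≤ C

-- IsVCThreshold H x  is  δ_VC(H) = x.
IsVCThreshold : ∀ {m} → Graph m → ℝ → Set₁
IsVCThreshold H = IsInfimum (BoundsVC H)

{-# OPTIONS --safe #-}

-- Write m = 2k+1.
--
-- Let δ(G) ≥ (1/m + ε)n and let S be a large shattered set.  For each s in S (but one) there
-- is a vertex v ≠ s adjacent to every other element of S and not to s, and by maximality a
-- path P of length 2k from v to s.  By Bonferroni two of its m vertices, say p_a and p_b,
-- have linearly many common neighbours; call such vertices close.  Among any m common
-- neighbours of close vertices two are close again, so by Ramsey close vertices are joined by
-- paths of every even length 2, 4, ..., avoiding any bounded set.  If b - a is odd such a path
-- completes p_a ... p_b to a copy of C_m.  If b - a is even, Ramsey gives many such paths P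
-- with the same a and b and with P(i) ≠ P′(j) for i < j; two of the sets N(p_a) ∩ N(p_b) have
-- a linear intersection, so p_a and p′_b are close, and p_0 ... p_a, an even path, and
-- p′_b ... p′_2k close up to a C_m because p_0 is adjacent to p′_2k.
--
-- Conversely, join set vertices v_A to element vertices s by an edge if s ∈ A and by a path
-- of length 2k otherwise; this forces v_A and s to stay non-adjacent in every C_m-free
-- extension.  Colour the path from v_A to s by 0, ..., 2k, attach to each colour class an
-- independent set of N new vertices, and join consecutive independent sets completely.  Then
-- every degree is at least N while n is about mN, and the graph maps homomorphically to
-- C_m, so a copy of C_m winds exactly once around the colours, which is impossible.
module Submission where

open import Data.Bool.Base using (Bool; true; false; T; _∧_; _∨_; if_then_else_)
open import Data.Bool.Properties using (T-≡; T-∨; T-∧; T?; ∨-comm)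
open import Data.Empty using (⊥; ⊥-elim)
open import Data.Fin.Base using (Fin; zero; suc; toℕ; combine; remQuot; join; splitAt; finToFun; funToFin)
open import Data.Fin.Properties as Finₚ using (toℕ<n; toℕ-fromℕ<; toℕ-injective; ¬∀⟶∃¬; remQuot-combine; splitAt-join; finToFun-funToFin; any?)
open import Data.Fin.Subset as Sub using (Subset; _∩_; _∪_; _∈_; _∉_; ∣_∣; ⁅_⁆; ∁; _-_; Nonempty; ⋃; inside; outside)
open import Data.Fin.Subset.Properties as Subₚ using (_∈?_; nonempty?; Empty-unique; ∣⊥∣≡0; ∣p∣≤n; p⊆q⇒∣p∣≤∣q∣; ∣⁅x⁆∣≡1; x∈⁅x⁆; x∈⁅y⁆⇒x≡y; x∈p∪q⁺; x∈p∩q⁺; x∈p∩q⁻; p∩q⊆p; x∉p⇒x∈∁p; x∈∁p⇒x∉p; x∈p∧x≢y⇒x∈p-y; x∈p⇒∣p-x∣<∣p∣; ∩-distribˡ-∪; ⊆-antisym)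
import Data.Integer.Properties as ℤₚ
open import Data.List.Base using (List; []; _∷_; _++_; length; map; filter; take; lookup; applyUpTo; upTo; allFin; cartesianProduct)
open import Data.List.Extrema.Nat using (v≤min⁺; min≤xs; v≤max⁺; max≤v⁺)
import Data.List.Membership.Propositional as LM
open import Data.List.Membership.Propositional.Properties using (∈-lookup; ∈-applyUpTo⁻; ∈-upTo⁺; ∈-cartesianProduct⁺; ∈-map⁺; ∈-++⁺ˡ; ∈-++⁺ʳ; ∈-allFin; ∈-filter⁺)
open import Data.List.Properties using (length-map; length-take; length-++; length-applyUpTo; length-tabulate)
open import Data.List.Relation.Binary.Sublist.Propositional using (_⊆_; []; _∷_; _∷ʳ_; ⊆-trans; minimum; from∈)
open import Data.List.Relation.Binary.Sublist.Propositional.Properties using (All-resp-⊆; filter-⊆; take-⊆)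
open import Data.List.Relation.Unary.All as All using (All; []; _∷_)
import Data.List.Relation.Unary.All.Properties as Allₚ
open import Data.List.Relation.Unary.AllPairs as AllPairs using (AllPairs; []; _∷_)
import Data.List.Relation.Unary.AllPairs.Properties as AllPairsₚ
open import Data.List.Relation.Unary.Any as Any using (here; there)
open import Data.List.Relation.Unary.Unique.Propositional using (Unique)
import Data.List.Relation.Unary.Unique.Propositional.Properties as Uniqueₚ
open import Data.Nat.Base using (ℕ; zero; suc; _+_; _*_; _^_; _∸_; _≤_; _<_; z≤n; s≤s; s≤s⁻¹; pred; NonZero; >-nonZero)
open import Data.Nat.DivMod as DivMod using (_%_; _mod_; m%n<n; m<n⇒m%n≡m; n%n≡0; [m+n]%n≡m%n; [m+kn]%n≡m%n; m≡m%n+[m/n]*n; m%n%n≡m%n; %-distribˡ-+; %-distribˡ-*)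
open import Data.Nat.Divisibility as Div using (divides; ∣m+n∣m⇒∣n; m∣m*n; n∣m*n; ∣m⇒∣m*n)
open import Data.Nat.ListAction using (sum)
open import Data.Nat.Properties
open import Data.Nat.Tactic.RingSolver using (solve-∀)
open import Data.Product.Base using (Σ; ∃; _×_; _,_; proj₁; proj₂)
open import Data.Rational.Base as ℚ using (ℚ; mkℚ; ↥_; ↧_; _/_; toℚᵘ)
import Data.Rational.Properties as ℚₚ
import Data.Rational.Unnormalised.Base as ℚᵘ
import Data.Rational.Unnormalised.Properties as ℚᵘₚ
open import Data.Sum.Base using (_⊎_; inj₁; inj₂; [_,_]′)
open import Data.Sum.Properties using (inj₁-injective; inj₂-injective)
open import Data.Unit.Base using (⊤; tt)
import Data.Vec.Base as Vec
open import Data.Vec.Properties using (lookup∘tabulate; []=⇒lookup; lookup⇒[]=)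
open import Function.Base using (_∘_; id)
open import Function.Bundles using (Equivalence)
open import Function.Definitions using (Injective)
open import Level using (Level)
open import Relation.Binary.Core using (Rel)
open import Relation.Binary.Definitions using () renaming (Decidable to Decidable₂)
open import Relation.Binary.PropositionalEquality using (_≡_; _≢_; refl; sym; trans; cong; cong₂; subst; subst₂; module ≡-Reasoning)
open import Relation.Nullary using (¬_; Dec; does; yes; no; contradiction; ¬?)
open import Relation.Nullary.Decidable using (map′; _×-dec_; _→-dec_; dec-true; dec-false; ¬¬-excluded-middle)
open import Relation.Unary using (Pred; Decidable)
open import Defs

open Graph

private
  variable
    a ℓ : Level
    A : Set a

-- Finite sets

∣p∪q∣+∣p∩q∣≡∣p∣+∣q∣ : ∀ {n} (p q : Subset n) → ∣ p ∪ q ∣ + ∣ p ∩ q ∣ ≡ ∣ p ∣ + ∣ q ∣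
∣p∪q∣+∣p∩q∣≡∣p∣+∣q∣ Vec.[]              Vec.[]              = refl
∣p∪q∣+∣p∩q∣≡∣p∣+∣q∣ (true  Vec.∷ p) (true  Vec.∷ q) =
  cong suc (trans (+-suc _ _) (trans (cong suc (∣p∪q∣+∣p∩q∣≡∣p∣+∣q∣ p q)) (sym (+-suc _ _))))
∣p∪q∣+∣p∩q∣≡∣p∣+∣q∣ (true  Vec.∷ p) (false Vec.∷ q) = cong suc (∣p∪q∣+∣p∩q∣≡∣p∣+∣q∣ p q)
∣p∪q∣+∣p∩q∣≡∣p∣+∣q∣ (false Vec.∷ p) (true  Vec.∷ q) =
  trans (cong suc (∣p∪q∣+∣p∩q∣≡∣p∣+∣q∣ p q)) (sym (+-suc _ _))
∣p∪q∣+∣p∩q∣≡∣p∣+∣q∣ (false Vec.∷ p) (false Vec.∷ q) = ∣p∪q∣+∣p∩q∣≡∣p∣+∣q∣ p q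

∣p∣≤1+∣p∩∁⁅x⁆∣ : ∀ {n} (p : Subset n) (x : Fin n) → ∣ p ∣ ≤ suc ∣ p ∩ ∁ ⁅ x ⁆ ∣
∣p∣≤1+∣p∩∁⁅x⁆∣ p x = begin
  ∣ p ∣                                     ≤⟨ p⊆q⇒∣p∣≤∣q∣ p⊆ ⟩
  ∣ ⁅ x ⁆ ∪ q ∣                             ≤⟨ m≤m+n _ _ ⟩
  ∣ ⁅ x ⁆ ∪ q ∣ + ∣ ⁅ x ⁆ ∩ q ∣             ≡⟨ ∣p∪q∣+∣p∩q∣≡∣p∣+∣q∣ ⁅ x ⁆ q ⟩
  ∣ ⁅ x ⁆ ∣ + ∣ q ∣                         ≡⟨ cong (_+ ∣ q ∣) (∣⁅x⁆∣≡1 x) ⟩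
  suc ∣ q ∣                                 ∎
  where
  open ≤-Reasoning
  q = p ∩ ∁ ⁅ x ⁆
  p⊆ : p Sub.⊆ ⁅ x ⁆ ∪ q
  p⊆ {y} y∈p with y ∈? ⁅ x ⁆
  ... | yes y∈x = x∈p∪q⁺ (inj₁ y∈x)
  ... | no  y∉x = x∈p∪q⁺ (inj₂ (x∈p∩q⁺ (y∈p , x∉p⇒x∈∁p y∉x)))

0<∣p∣⇒Nonempty : ∀ {n} (p : Subset n) → 0 < ∣ p ∣ → Nonempty p
0<∣p∣⇒Nonempty {n} p 0<∣p∣ with nonempty? p
... | yes ne = ne
... | no  ¬ne = contradiction (trans (cong ∣_∣ (Empty-unique ¬ne)) (∣⊥∣≡0 n)) (>⇒≢ 0<∣p∣)

element-avoiding : ∀ {n} (p : Subset n) (xs : List (Fin n)) → length xs < ∣ p ∣ → ∃ λ x → x ∈ p × x LM.∉ xs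
element-avoiding p []       h = let (x , x∈p) = 0<∣p∣⇒Nonempty p h in x , x∈p , λ ()
element-avoiding p (y ∷ xs) h =
  let (x , x∈ , x∉) = element-avoiding (p ∩ ∁ ⁅ y ⁆) xs (s≤s⁻¹ (≤-trans h (∣p∣≤1+∣p∩∁⁅x⁆∣ p y)))
      (x∈p , x∈∁y) = x∈p∩q⁻ p _ x∈
  in x , x∈p , λ { (here x≡y) → x∈∁p⇒x∉p x∈∁y (subst (_∈ ⁅ y ⁆) (sym x≡y) (x∈⁅x⁆ y)) ; (there x∈xs) → x∉ x∈xs }

elements-avoiding : ∀ {n} (p : Subset n) (xs : List (Fin n)) (r : ℕ) → length xs + r ≤ ∣ p ∣ →
  ∃ λ ys → length ys ≡ r × Unique ys × All (_∈ p) ys × All (LM._∉ xs) ys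
elements-avoiding p xs zero    h = [] , refl , [] , [] , []
elements-avoiding p xs (suc r) h =
  let h′ = ≤-trans (≤-reflexive (sym (+-suc (length xs) r))) h
      (y , y∈ , y∉) = element-avoiding p xs (≤-trans (s≤s (m≤m+n _ r)) h′)
      (ys , len , uniq , ys∈ , ys∉) = elements-avoiding p (y ∷ xs) r h′
  in y ∷ ys , cong suc len
     , All.map (λ z∉ y≡z → z∉ (here (sym y≡z))) ys∉ ∷ uniq
     , y∈ ∷ ys∈ , y∉ ∷ All.map (λ z∉ z∈ → z∉ (there z∈)) ys∉

Unique⇒length≤∣p∣ : ∀ {n} (p : Subset n) {xs : List (Fin n)} → Unique xs → All (_∈ p) xs → length xs ≤ ∣ p ∣
Unique⇒length≤∣p∣ p []           []           = z≤n
Unique⇒length≤∣p∣ p (x∉xs ∷ uniq) (x∈p ∷ xs∈p) = ≤-trans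
  (s≤s (Unique⇒length≤∣p∣ (p - _) uniq
    (All.zipWith (λ (x≢y , y∈p) → x∈p∧x≢y⇒x∈p-y y∈p (x≢y ∘ sym)) (x∉xs , xs∈p))))
  (x∈p⇒∣p-x∣<∣p∣ x∈p)

module _ {n : ℕ} (f : A → Subset n) (K : ℕ) where

  ∩-⋃-sparse : (p : Subset n) {xs : List A} → All (λ x → K * ∣ p ∩ f x ∣ ≤ n) xs →
    K * ∣ p ∩ ⋃ (map f xs) ∣ ≤ length xs * n
  ∩-⋃-sparse p [] rewrite Subₚ.∩-zeroʳ p | ∣⊥∣≡0 n | *-zeroʳ K = z≤n
  ∩-⋃-sparse p {x ∷ xs} (px ∷ pxs) = begin
    K * ∣ p ∩ (f x ∪ ⋃ (map f xs)) ∣             ≡⟨ cong (λ q → K * ∣ q ∣) (∩-distribˡ-∪ p (f x) _) ⟩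
    K * ∣ (p ∩ f x) ∪ (p ∩ ⋃ (map f xs)) ∣       ≤⟨ *-monoʳ-≤ K (≤-trans (m≤m+n _ _) (≤-reflexive (∣p∪q∣+∣p∩q∣≡∣p∣+∣q∣ (p ∩ f x) _))) ⟩
    K * (∣ p ∩ f x ∣ + ∣ p ∩ ⋃ (map f xs) ∣)     ≡⟨ *-distribˡ-+ K ∣ p ∩ f x ∣ _ ⟩
    K * ∣ p ∩ f x ∣ + K * ∣ p ∩ ⋃ (map f xs) ∣   ≤⟨ +-mono-≤ px (∩-⋃-sparse p pxs) ⟩
    n + length xs * n                            ∎
    where open ≤-Reasoning

  -- Bonferroni's inequality without denominators: a new set meets the union of the l others in at
  -- most `l * n / K` elements, and `l * l` is a crude count of the pairs that suits the induction.
  bonferroni : {xs : List A} → AllPairs (λ x y → K * ∣ f x ∩ f y ∣ ≤ n) xs →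
    K * sum (map (∣_∣ ∘ f) xs) ≤ K * ∣ ⋃ (map f xs) ∣ + length xs * length xs * n
  bonferroni [] rewrite *-zeroʳ K = z≤n
  bonferroni {x ∷ xs} (px ∷ pxs) = begin
    K * (∣ f x ∣ + sum (map (∣_∣ ∘ f) xs))                  ≡⟨ *-distribˡ-+ K ∣ f x ∣ _ ⟩
    K * ∣ f x ∣ + K * sum (map (∣_∣ ∘ f) xs)                ≤⟨ +-monoʳ-≤ (K * ∣ f x ∣) (bonferroni pxs) ⟩
    K * ∣ f x ∣ + (K * ∣ U ∣ + l * l * n)                   ≡⟨ lem₁ K ∣ f x ∣ ∣ U ∣ (l * l * n) ⟩
    K * (∣ f x ∣ + ∣ U ∣) + l * l * n                       ≡⟨ cong (λ s → K * s + l * l * n) (sym (∣p∪q∣+∣p∩q∣≡∣p∣+∣q∣ (f x) U)) ⟩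
    K * (∣ f x ∪ U ∣ + ∣ f x ∩ U ∣) + l * l * n             ≡⟨ lem₂ K ∣ f x ∪ U ∣ ∣ f x ∩ U ∣ (l * l * n) ⟩
    K * ∣ f x ∪ U ∣ + (K * ∣ f x ∩ U ∣ + l * l * n)         ≤⟨ +-monoʳ-≤ (K * ∣ f x ∪ U ∣) (+-monoˡ-≤ (l * l * n) (∩-⋃-sparse (f x) px)) ⟩
    K * ∣ f x ∪ U ∣ + (l * n + l * l * n)                   ≤⟨ +-monoʳ-≤ (K * ∣ f x ∪ U ∣) (≤-trans (m≤m+n _ (n + l * n)) (≤-reflexive (lem₃ l n))) ⟩
    K * ∣ f x ∪ U ∣ + suc l * suc l * n                     ∎
    where
    open ≤-Reasoning
    l = length xs
    U = ⋃ (map f xs)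
    lem₁ : ∀ K a b c → K * a + (K * b + c) ≡ K * (a + b) + c
    lem₁ = solve-∀
    lem₂ : ∀ K a b c → K * (a + b) + c ≡ K * a + (K * b + c)
    lem₂ = solve-∀
    lem₃ : ∀ l n → l * n + l * l * n + (n + l * n) ≡ suc l * suc l * n
    lem₃ = solve-∀

sum-map-≥ : (g : A → ℕ) (b c : ℕ) (xs : List A) → All (λ x → c ≤ b * g x) xs → length xs * c ≤ b * sum (map g xs)
sum-map-≥ g b c []       []         rewrite *-zeroʳ b = z≤n
sum-map-≥ g b c (x ∷ xs) (px ∷ pxs) = ≤-trans (+-mono-≤ px (sum-map-≥ g b c xs pxs))
  (≤-reflexive (sym (*-distribˡ-+ b (g x) _)))

-- Since `l * α` is at least `β + 1`, the sizes add up to at least (1 + 1/β) n. If all pairs met in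
-- at most n / K elements, Bonferroni would leave an error of at most `l * l` n / K, and K =
-- `1 + l * l * β` makes this smaller than the excess n / β.
dense-family-intersects : {n′ : ℕ} (f : A → Subset (suc n′)) (α β : ℕ) {l : ℕ} (xs : List A) → length xs ≡ l → β < l * α →
  All (λ x → α * suc n′ ≤ β * ∣ f x ∣) xs →
  ¬ AllPairs (λ x y → (1 + l * l * β) * ∣ f x ∩ f y ∣ ≤ suc n′) xs
dense-family-intersects {n′ = n′} f α β xs refl β<lα dense sparse = <-irrefl refl (begin-strict
  K * β * N + (l * l * β) * N               <⟨ +-monoʳ-< (K * β * N) (*-monoˡ-< N (n<1+n (l * l * β))) ⟩
  K * β * N + K * N                         ≡⟨ lem₁ K β N ⟩
  K * (suc β * N)                           ≤⟨ *-monoʳ-≤ K (*-monoˡ-≤ N β<lα) ⟩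
  K * (l * α * N)                           ≡⟨ cong (K *_) (*-assoc l α N) ⟩
  K * (l * (α * N))                         ≤⟨ *-monoʳ-≤ K (sum-map-≥ (∣_∣ ∘ f) β (α * N) xs dense) ⟩
  K * (β * sum (map (∣_∣ ∘ f) xs))          ≡⟨ lem₂ K β (sum (map (∣_∣ ∘ f) xs)) ⟩
  β * (K * sum (map (∣_∣ ∘ f) xs))          ≤⟨ *-monoʳ-≤ β (bonferroni f K sparse) ⟩
  β * (K * ∣ ⋃ (map f xs) ∣ + l * l * N)    ≤⟨ *-monoʳ-≤ β (+-monoˡ-≤ (l * l * N) (*-monoʳ-≤ K (∣p∣≤n (⋃ (map f xs))))) ⟩
  β * (K * N + l * l * N)                   ≡⟨ lem₃ K β N l ⟩
  K * β * N + (l * l * β) * N               ∎)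
  where
  open ≤-Reasoning
  N = suc n′
  l = length xs
  K = 1 + l * l * β
  lem₁ : ∀ K β n → K * β * n + K * n ≡ K * (suc β * n)
  lem₁ = solve-∀
  lem₂ : ∀ K β s → K * (β * s) ≡ β * (K * s)
  lem₂ = solve-∀
  lem₃ : ∀ K β n l → β * (K * n + l * l * n) ≡ K * β * n + (l * l * β) * n
  lem₃ = solve-∀

-- Ramsey's theorem

AllPairs-resp-⊆ : {R : Rel A ℓ} {xs ys : List A} → xs ⊆ ys → AllPairs R ys → AllPairs R xs
AllPairs-resp-⊆ []          []       = []
AllPairs-resp-⊆ (_ ∷ʳ p)    (_ ∷ rs) = AllPairs-resp-⊆ p rs
AllPairs-resp-⊆ (refl ∷ p)  (r ∷ rs) = All-resp-⊆ p r ∷ AllPairs-resp-⊆ p rs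

length-filter-¬ : {P : Pred A ℓ} (P? : Decidable P) (xs : List A) →
  length (filter P? xs) + length (filter (¬? ∘ P?) xs) ≡ length xs
length-filter-¬ P? []       = refl
length-filter-¬ P? (x ∷ xs) with P? x
... | yes _ = cong suc (length-filter-¬ P? xs)
... | no  _ = trans (+-suc _ _) (cong suc (length-filter-¬ P? xs))

-- Returning the pair as a sublist keeps its order, so a pair found among the positions of a path
-- comes out increasing.
¬AllPairs¬⇒pair : {R : Rel A ℓ} → Decidable₂ R → (xs : List A) → ¬ AllPairs (λ x y → ¬ R x y) xs →
  ∃ λ x → ∃ λ y → (x ∷ y ∷ []) ⊆ xs × R x y
¬AllPairs¬⇒pair R? []       ¬none = contradiction [] ¬none
¬AllPairs¬⇒pair R? (x ∷ xs) ¬none with Any.any? (R? x) xs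
... | yes xRxs = let (y , y∈xs , xRy) = LM.find xRxs in x , y , refl ∷ from∈ y∈xs , xRy
... | no  ¬xRxs =
  let (y , z , yz⊆xs , yRz) = ¬AllPairs¬⇒pair R? xs (¬none ∘ (Allₚ.¬Any⇒All¬ xs ¬xRxs ∷_))
  in y , z , x ∷ʳ yz⊆xs , yRz

ramseyNumber : ℕ → ℕ → ℕ
ramseyNumber zero    _       = 0
ramseyNumber (suc p) zero    = 0
ramseyNumber (suc p) (suc q) = suc (ramseyNumber p (suc q) + ramseyNumber (suc p) q)

m+n≤o+p⇒m≤o⊎n≤p : ∀ {m n o p} → m + n ≤ o + p → m ≤ o ⊎ n ≤ p
m+n≤o+p⇒m≤o⊎n≤p {m} {n} {o} {p} h with m ≤? o | n ≤? p
... | yes m≤o | _       = inj₁ m≤o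
... | no  _   | yes n≤p = inj₂ n≤p
... | no  m≰o | no n≰p  = contradiction h (<⇒≱ (+-mono-< (≰⇒> m≰o) (≰⇒> n≰p)))

HasSublist : (List A → Set ℓ) → ℕ → List A → Set _
HasSublist P r xs = ∃ λ ys → ys ⊆ xs × length ys ≡ r × P ys

module _ {A : Set a} {R : Rel A ℓ} (R? : Decidable₂ R) where

  -- The head splits the tail into the elements related to it and the others, and one of the two
  -- parts is long enough. Pairs are taken in list order, so `R` may be asymmetric, as it is for the
  -- patterns of paths below.
  ramsey : ∀ p q (xs : List A) → ramseyNumber p q ≤ length xs →
    HasSublist (AllPairs R) p xs ⊎ HasSublist (AllPairs (λ x y → ¬ R x y)) q xs
  ramsey zero    q       xs       _ = inj₁ ([] , minimum xs , refl , [])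
  ramsey (suc p) zero    xs       _ = inj₂ ([] , minimum xs , refl , [])
  ramsey (suc p) (suc q) (x ∷ xs) (s≤s h)
    with m+n≤o+p⇒m≤o⊎n≤p (≤-trans h (≤-reflexive (sym (length-filter-¬ (R? x) xs))))
  ... | inj₁ h₁ with ramsey p (suc q) (filter (R? x) xs) h₁
  ...   | inj₁ (ys , ys⊆ , len , rs) = inj₁
    (x ∷ ys , refl ∷ ⊆-trans ys⊆ (filter-⊆ (R? x) xs) , cong suc len , All-resp-⊆ ys⊆ (Allₚ.all-filter (R? x) xs) ∷ rs)
  ...   | inj₂ (ys , ys⊆ , len , rs) = inj₂ (ys , x ∷ʳ ⊆-trans ys⊆ (filter-⊆ (R? x) xs) , len , rs)
  ramsey (suc p) (suc q) (x ∷ xs) (s≤s h) | inj₂ h₂ with ramsey (suc p) q (filter (¬? ∘ R? x) xs) h₂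
  ...   | inj₁ (ys , ys⊆ , len , rs) = inj₁ (ys , x ∷ʳ ⊆-trans ys⊆ (filter-⊆ (¬? ∘ R? x) xs) , len , rs)
  ...   | inj₂ (ys , ys⊆ , len , rs) = inj₂
    (x ∷ ys , refl ∷ ⊆-trans ys⊆ (filter-⊆ (¬? ∘ R? x) xs) , cong suc len , All-resp-⊆ ys⊆ (Allₚ.all-filter (¬? ∘ R? x) xs) ∷ rs)

Homogeneous : Rel A ℓ → List A → Set _
Homogeneous R xs = AllPairs R xs ⊎ AllPairs (λ x y → ¬ R x y) xs

multiRamseyNumber : ℕ → ℕ → ℕ
multiRamseyNumber zero    r = r
multiRamseyNumber (suc c) r = let r′ = multiRamseyNumber c r in ramseyNumber r′ r′

module _ {A : Set a} {I : Set} {R : I → Rel A ℓ} (R? : ∀ i → Decidable₂ (R i)) where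

  -- One application of `ramsey` for each relation; homogeneity for the relations already treated
  -- passes to sublists.
  multiRamsey : ∀ is r (xs : List A) → multiRamseyNumber (length is) r ≤ length xs →
    ∃ λ ys → ys ⊆ xs × length ys ≡ r × All (λ i → Homogeneous (R i) ys) is
  multiRamsey []       r xs h = take r xs , take-⊆ r xs , trans (length-take r xs) (m≤n⇒m⊓n≡m h) , []
  multiRamsey (i ∷ is) r xs h with ramsey (R? i) _ _ xs h
  ... | inj₁ (ys , ys⊆ , len , rs) =
    let (zs , zs⊆ , len′ , homs) = multiRamsey is r ys (≤-reflexive (sym len))
    in zs , ⊆-trans zs⊆ ys⊆ , len′ , inj₁ (AllPairs-resp-⊆ zs⊆ rs) ∷ homs
  ... | inj₂ (ys , ys⊆ , len , rs) =
    let (zs , zs⊆ , len′ , homs) = multiRamsey is r ys (≤-reflexive (sym len))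
    in zs , ⊆-trans zs⊆ ys⊆ , len′ , inj₂ (AllPairs-resp-⊆ zs⊆ rs) ∷ homs

-- Cycles and paths

does⇒ : (a? : Dec A) → T (does a?) → A
does⇒ (yes a) _ = a

⇒does : (a? : Dec A) → A → T (does a?)
⇒does (yes _) _ = _
⇒does (no ¬a) a = ¬a a

Adj-sym : ∀ {n} (G : Graph n) {u v : Fin n} → Adj G u v → Adj G v u
Adj-sym G {u} {v} = subst T (adj-sym G u v)

cycle-Adj⁻ : ∀ {m} .{{_ : NonZero m}} (3≤m : 3 ≤ m) {i j : Fin m} → Adj (cycle m 3≤m) i j →
  suc (toℕ i) % m ≡ toℕ j ⊎ suc (toℕ j) % m ≡ toℕ i
cycle-Adj⁻ {m} _ {i} {j} h with Equivalence.to (T-∨ {does (suc (toℕ i) % m ≟ toℕ j)}) h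
... | inj₁ h₁ = inj₁ (does⇒ (suc (toℕ i) % m ≟ toℕ j) h₁)
... | inj₂ h₂ = inj₂ (does⇒ (suc (toℕ j) % m ≟ toℕ i) h₂)

cycle-Adj⁺ : ∀ {m} .{{_ : NonZero m}} (3≤m : 3 ≤ m) {i j : Fin m} → suc (toℕ i) % m ≡ toℕ j → Adj (cycle m 3≤m) i j
cycle-Adj⁺ {m} _ {i} {j} h =
  Equivalence.from (T-∨ {does (suc (toℕ i) % m ≟ toℕ j)}) (inj₁ (⇒does (suc (toℕ i) % m ≟ toℕ j) h))

infixr 5 _∷_

data Walk {n} (G : Graph n) : Fin n → List (Fin n) → Fin n → Set where
  [_] : ∀ x → Walk G x (x ∷ []) x
  _∷_ : ∀ {x y z ys} → Adj G x y → Walk G y ys z → Walk G x (x ∷ ys) z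

module _ {n : ℕ} {G : Graph n} where

  Walk-++ : ∀ {x xs y z zs w} → Walk G x xs y → Adj G y z → Walk G z zs w → Walk G x (xs ++ zs) w
  Walk-++ [ _ ]   e w = e ∷ w
  Walk-++ (a ∷ v) e w = a ∷ Walk-++ v e w

  Walk-applyUpTo : (f : ℕ → Fin n) (l : ℕ) → (∀ r → r < l → Adj G (f r) (f (suc r))) →
    Walk G (f 0) (applyUpTo f (suc l)) (f l)
  Walk-applyUpTo f zero    step = [ f 0 ]
  Walk-applyUpTo f (suc l) step = step 0 (s≤s z≤n) ∷ Walk-applyUpTo (f ∘ suc) l (λ r r<l → step (suc r) (s≤s r<l))

  Walk-head : ∀ {x xs y} → Walk G x xs y → (i : Fin (length xs)) → toℕ i ≡ 0 → lookup xs i ≡ x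
  Walk-head [ _ ]   zero _ = refl
  Walk-head (_ ∷ _) zero _ = refl

  Walk-last : ∀ {x xs y} → Walk G x xs y → (i : Fin (length xs)) → suc (toℕ i) ≡ length xs → lookup xs i ≡ y
  Walk-last [ _ ]   zero    _  = refl
  Walk-last (_ ∷ [ _ ])   zero    ()
  Walk-last (_ ∷ (_ ∷ _)) zero    ()
  Walk-last (_ ∷ w) (suc i) eq = Walk-last w i (suc-injective eq)

  Walk-step : ∀ {x xs y} → Walk G x xs y → (i j : Fin (length xs)) → suc (toℕ i) ≡ toℕ j → Adj G (lookup xs i) (lookup xs j)
  Walk-step [ _ ]   zero    zero    ()
  Walk-step (a ∷ w) zero    (suc j) eq = subst (Adj G _) (sym (Walk-head w j (sym (suc-injective eq)))) a
  Walk-step (a ∷ w) (suc i) (suc j) eq = Walk-step w i j (suc-injective eq)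

Unique⇒lookup-injective : {xs : List A} → Unique xs → Injective _≡_ _≡_ (lookup xs)
Unique⇒lookup-injective (_ ∷ _)  {zero}  {zero}  _  = refl
Unique⇒lookup-injective (x∉ ∷ _) {zero}  {suc j} eq = contradiction eq (All.lookup x∉ (∈-lookup j))
Unique⇒lookup-injective (x∉ ∷ _) {suc i} {zero}  eq = contradiction (sym eq) (All.lookup x∉ (∈-lookup i))
Unique⇒lookup-injective (_ ∷ u)  {suc i} {suc j} eq = cong suc (Unique⇒lookup-injective u eq)

closedWalk⇒cycle : ∀ {n} {G : Graph n} {m} .{{_ : NonZero m}} (3≤m : 3 ≤ m) {x xs y} →
  length xs ≡ m → Walk G x xs y → Adj G y x → Unique xs → Contains (cycle m 3≤m) G
closedWalk⇒cycle {G = G} {m} 3≤m {x} {xs} {y} refl w y~x uniq = lookup xs , Unique⇒lookup-injective uniq , hom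
  where
  next : ∀ i j → suc (toℕ i) % m ≡ toℕ j → Adj G (lookup xs i) (lookup xs j)
  next i j eq with m≤n⇒m<n∨m≡n (toℕ<n i)
  ... | inj₁ 1+i<m = Walk-step w i j (trans (sym (m<n⇒m%n≡m 1+i<m)) eq)
  ... | inj₂ 1+i≡m = subst₂ (Adj G) (sym (Walk-last w i 1+i≡m))
    (sym (Walk-head w j (trans (sym eq) (trans (cong (_% m) 1+i≡m) (n%n≡0 m))))) y~x

  hom : ∀ i j → Adj (cycle m 3≤m) i j → Adj G (lookup xs i) (lookup xs j)
  hom i j h with cycle-Adj⁻ 3≤m h
  ... | inj₁ eq = next i j eq
  ... | inj₂ eq = Adj-sym G (next j i eq)

-- As l is -1 modulo l + 1, adding `i * l` undoes the addition of i.
+-%-cancelˡ : ∀ l i {a b} → a < suc l → b < suc l → (i + a) % suc l ≡ (i + b) % suc l → a ≡ b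
+-%-cancelˡ l i {a} {b} a< b< eq = trans (sym (shift a a<)) (trans (cong (λ t → (i * l % suc l + t) % suc l) eq) (shift b b<))
  where
  lem : ∀ l i a → i * l + (i + a) ≡ a + i * suc l
  lem = solve-∀
  shift : ∀ a → a < suc l → (i * l % suc l + (i + a) % suc l) % suc l ≡ a
  shift a a< = trans (sym (%-distribˡ-+ (i * l) (i + a) (suc l)))
    (trans (cong (_% suc l) (lem l i a)) (trans ([m+kn]%n≡m%n a i (suc l)) (m<n⇒m%n≡m a<)))

[1+m%n]%n≡[1+m]%n : ∀ i l → suc (i % suc l) % suc l ≡ suc i % suc l
[1+m%n]%n≡[1+m]%n i l with l
... | zero  = trans (lem (suc (i % 1))) (sym (lem (suc i)))
  where
  lem : ∀ j → j % 1 ≡ 0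
  lem j = n<1⇒n≡0 (m%n<n j 1)
... | suc l′ = sym (trans (%-distribˡ-+ 1 i (suc (suc l′))) (cong (λ t → (t + i % suc (suc l′)) % suc (suc l′)) (m<n⇒m%n≡m {suc (suc l′)} {1} (s≤s (s≤s z≤n)))))

module _ {l : ℕ} (f : Fin (suc l) → A) where

  unroll : ℕ → A
  unroll i = f (i mod suc l)

  unroll-toℕ : ∀ i → unroll (toℕ i) ≡ f i
  unroll-toℕ i = cong f (toℕ-injective (trans (toℕ-fromℕ< _) (m<n⇒m%n≡m (toℕ<n i))))

  unroll-cong : ∀ i j → i % suc l ≡ j % suc l → unroll i ≡ unroll j
  unroll-cong i j eq = cong f (toℕ-injective (trans (toℕ-fromℕ< _) (trans eq (sym (toℕ-fromℕ< _)))))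

  unroll-injective : Injective _≡_ _≡_ f → ∀ i j → unroll i ≡ unroll j → i % suc l ≡ j % suc l
  unroll-injective inj i j eq = trans (sym (toℕ-fromℕ< _)) (trans (cong toℕ (inj eq)) (toℕ-fromℕ< _))

unroll-Adj : ∀ {n l} (G : Graph n) (3≤m : 3 ≤ suc l) (f : Fin (suc l) → Fin n) →
  (∀ u v → Adj (cycle (suc l) 3≤m) u v → Adj G (f u) (f v)) → ∀ i → Adj G (unroll f i) (unroll f (suc i))
unroll-Adj {l = l} G 3≤m f hom i = hom _ _ (cycle-Adj⁺ 3≤m
  (trans (cong (λ t → suc t % suc l) (toℕ-fromℕ< _)) (trans ([1+m%n]%n≡[1+m]%n i l) (sym (toℕ-fromℕ< _)))))

-- `vertex` is defined on all of ℕ but constrained only up to l, so segments are obtained by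
-- shifting the index, without bounded index types.
record Path {n} (G : Graph n) (l : ℕ) (x y : Fin n) : Set where
  field
    vertex   : ℕ → Fin n
    start    : vertex 0 ≡ x
    end      : vertex l ≡ y
    step     : ∀ r → r < l → Adj G (vertex r) (vertex (suc r))
    distinct : ∀ {i j} → i < j → j ≤ l → vertex i ≢ vertex j

open Path

reversePath : ∀ {n} {G : Graph n} {l x y} → Path G l x y → Path G l y x
reversePath {G = G} {l} P = record
  { vertex   = λ r → vertex P (l ∸ r)
  ; start    = end P
  ; end      = trans (cong (vertex P) (n∸n≡0 l)) (start P)
  ; step     = λ r r<l → Adj-sym G (subst (λ t → Adj G (vertex P (l ∸ suc r)) (vertex P t)) (sym (lem r<l))
                 (step P (l ∸ suc r) (≤-trans (≤-reflexive (sym (lem r<l))) (m∸n≤m l r))))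
  ; distinct = λ {i} {j} i<j j≤l eq → distinct P (∸-monoʳ-< i<j j≤l) (m∸n≤m l i) (sym eq)
  }
  where
  lem : ∀ {r l} → r < l → l ∸ r ≡ suc (l ∸ suc r)
  lem {r} {l} r<l = +-∸-assoc 1 r<l

-- Cycles through an added edge

addEdge-Adj⁻ : ∀ {n} (G : Graph n) {x y} (x≢y : x ≢ y) {u v} → Adj (addEdge G x y x≢y) u v →
  Adj G u v ⊎ (u ≡ x × v ≡ y) ⊎ (u ≡ y × v ≡ x)
addEdge-Adj⁻ G {x} {y} x≢y {u} {v} h with Equivalence.to (T-∨ {adj G u v}) h
... | inj₁ e = inj₁ e
... | inj₂ j with Equivalence.to (T-∨ {does (u Finₚ.≟ x) ∧ does (v Finₚ.≟ y)}) j
...   | inj₁ xy = let (a , b) = Equivalence.to T-∧ xy in inj₂ (inj₁ (does⇒ (u Finₚ.≟ x) a , does⇒ (v Finₚ.≟ y) b))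
...   | inj₂ yx = let (a , b) = Equivalence.to T-∧ yx in inj₂ (inj₂ (does⇒ (u Finₚ.≟ y) a , does⇒ (v Finₚ.≟ x) b))

module _ {n l : ℕ} {G : Graph n} (3≤m : 3 ≤ suc l) {x y : Fin n} (x≢y : x ≢ y) (f : Fin (suc l) → Fin n)
  (inj : Injective _≡_ _≡_ f) (hom : ∀ u v → Adj (cycle (suc l) 3≤m) u v → Adj (addEdge G x y x≢y) (f u) (f v)) where

  private
    m = suc l
    g = unroll f

    edge : ∀ i → Adj (addEdge G x y x≢y) (g i) (g (suc i))
    edge = unroll-Adj (addEdge G x y x≢y) 3≤m f hom

  -- The path goes the long way round from position i + 1 back to position i. None of its edges is
  -- the new one, because the new edge already sits between i and i + 1 and the copy is injective.
  rest-of-cycle : ∀ i → (g i ≡ x × g (suc i) ≡ y) ⊎ (g i ≡ y × g (suc i) ≡ x) → Path G l (g (suc i)) (g i)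
  rest-of-cycle i ends = record
    { vertex   = λ r → g (suc i + r)
    ; start    = cong g (+-identityʳ (suc i))
    ; end      = unroll-cong f (suc i + l) i (trans (cong (_% m) (sym (+-suc i l))) ([m+n]%n≡m%n i m))
    ; step     = old
    ; distinct = λ {a} {b} a<b b≤l eq → <⇒≢ a<b (+-%-cancelˡ l (suc i) (≤-trans a<b (≤-trans b≤l (n≤1+n l))) (s≤s b≤l) (unroll-injective f inj (suc i + a) (suc i + b) eq))
    }
    where
    old : ∀ r → r < l → Adj G (g (suc i + r)) (g (suc i + suc r))
    old r r<l with addEdge-Adj⁻ G x≢y (subst (λ t → Adj (addEdge G x y x≢y) (g (suc i + r)) (g t)) (sym (+-suc (suc i) r)) (edge (suc i + r)))
    ... | inj₁ e = e
    ... | inj₂ e = ⊥-elim (absurd ends e)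
      where
      far : ∀ {a} → a < m → g (suc i + r) ≡ g (i + a) → suc r ≡ a
      far {a} a<m eq = +-%-cancelˡ l i (s≤s r<l) a<m
        (trans (cong (_% m) (+-suc i r)) (unroll-injective f inj (suc i + r) (i + a) eq))
      not-g-i : ∀ {z} → g (suc i + r) ≡ z → g i ≡ z → ⊥
      not-g-i p q = contradiction (far {0} (s≤s z≤n) (trans p (trans (sym q) (cong g (sym (+-identityʳ i)))))) λ ()
      -- If the new edge recurred in the opposite direction, r would be 0 and position i + 2 would
      -- coincide with i, which is impossible as the cycle has at least 3 vertices.
      not-g-1+i : ∀ {z w} → g (suc i + r) ≡ z → g (suc i) ≡ z → g (suc i + suc r) ≡ w → g i ≡ w → ⊥
      not-g-1+i p q s t with far {1} (≤-trans (s≤s (s≤s z≤n)) 3≤m) (trans p (trans (sym q) (cong g (+-comm 1 i))))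
      ... | refl = contradiction (+-%-cancelˡ l i {2} {0} 3≤m (s≤s z≤n)
        (trans (cong (_% m) (+-suc i 1)) (unroll-injective f inj (suc i + 1) (i + 0) (trans s (trans (sym t) (cong g (sym (+-identityʳ i)))))))) λ ()
      absurd : (g i ≡ x × g (suc i) ≡ y) ⊎ (g i ≡ y × g (suc i) ≡ x) →
        (g (suc i + r) ≡ x × g (suc i + suc r) ≡ y) ⊎ (g (suc i + r) ≡ y × g (suc i + suc r) ≡ x) → ⊥
      absurd (inj₁ (a , b)) (inj₁ (c , d)) = not-g-i c a
      absurd (inj₁ (a , b)) (inj₂ (c , d)) = not-g-1+i c b d a
      absurd (inj₂ (a , b)) (inj₁ (c , d)) = not-g-1+i c b d a
      absurd (inj₂ (a , b)) (inj₂ (c , d)) = not-g-i c a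

  cycle-uses-new-edge : Free (cycle m 3≤m) G → ∃ λ i → ¬ Adj G (g i) (g (suc i))
  cycle-uses-new-edge free =
    let (i , ¬e) = ¬∀⟶∃¬ m (λ i → Adj G (g (toℕ i)) (g (suc (toℕ i)))) (λ i → T? _) all-old⇒⊥
    in toℕ i , ¬e
    where
    module _ (all-old : (i : Fin m) → Adj G (g (toℕ i)) (g (suc (toℕ i)))) where
      next : ∀ u v → suc (toℕ u) % m ≡ toℕ v → Adj G (f u) (f v)
      next u v eq = subst₂ (Adj G) (unroll-toℕ f u)
        (trans (unroll-cong f (suc (toℕ u)) (toℕ v) (trans (sym (m<n⇒m%n≡m (m%n<n (suc (toℕ u)) m))) (cong (_% m) eq))) (unroll-toℕ f v)) (all-old u)

      hom′ : ∀ u v → Adj (cycle m 3≤m) u v → Adj G (f u) (f v)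
      hom′ u v h with cycle-Adj⁻ 3≤m h
      ... | inj₁ eq = next u v eq
      ... | inj₂ eq = Adj-sym G (next v u eq)

      all-old⇒⊥ : ⊥
      all-old⇒⊥ = free (f , inj , hom′)

  addEdge⇒Path : Free (cycle m 3≤m) G → Path G l x y
  addEdge⇒Path free with cycle-uses-new-edge free
  ... | i , ¬e with addEdge-Adj⁻ G x≢y (edge i)
  ...   | inj₁ e = contradiction e ¬e
  ...   | inj₂ ends@(inj₁ (a , b)) = reversePath (subst₂ (Path G l) b a (rest-of-cycle i ends))
  ...   | inj₂ ends@(inj₂ (a , b)) = subst₂ (Path G l) b a (rest-of-cycle i ends)

-- Minimum degree above n/(2k+1)

∈-neighbourhood⁺ : ∀ {n} (G : Graph n) {u v} → Adj G u v → v ∈ neighbourhood G u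
∈-neighbourhood⁺ G {u} {v} e = lookup⇒[]= v _ (trans (lookup∘tabulate (adj G u) v) (Equivalence.to T-≡ e))

∈-neighbourhood⁻ : ∀ {n} (G : Graph n) {u v} → v ∈ neighbourhood G u → Adj G u v
∈-neighbourhood⁻ G {u} {v} h = Equivalence.from T-≡ (trans (sym (lookup∘tabulate (adj G u) v)) ([]=⇒lookup h))

even⊎odd : ∀ d → ∃ λ t → d ≡ 2 * t ⊎ d ≡ 1 + 2 * t
even⊎odd zero    = 0 , inj₁ refl
even⊎odd (suc d) with even⊎odd d
... | t , inj₁ refl = t , inj₂ refl
... | t , inj₂ refl = suc t , inj₁ (lem t)
  where
  lem : ∀ t → suc (1 + 2 * t) ≡ 2 * suc t
  lem = solve-∀

module UpperBound (k : ℕ) (1≤k : 1 ≤ k) (e : ℕ) where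

  -- `K` and `K₂` are the constants of `dense-family-intersects` for m neighbourhoods of density (e
  -- + 1) / (e m) and for K + 1 common neighbourhoods of density 1 / K. Among `R` vertices there are
  -- k + 1 pairwise close ones, since no m are pairwise not close.
  m K K₂ R : ℕ
  m  = 1 + 2 * k
  K  = 1 + m * m * (e * m)
  K₂ = 1 + suc K * suc K * K
  R  = ramseyNumber (suc k) m

  -- Above this order, vertices close with constant at most `K₂` have enough common neighbours to
  -- avoid m forbidden vertices, to apply Ramsey to R others, or to weave a path through k + 1 of
  -- them.
  order-bound : ℕ
  order-bound = K₂ * (m + (R + 2 * suc k))

  3≤m : 3 ≤ m
  3≤m = s≤s (*-monoʳ-≤ 2 1≤k)

  K≤K₂ : K ≤ K₂
  K≤K₂ = ≤-trans (m≤m+n K _) (n≤1+n _)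

  positions : List (ℕ × ℕ)
  positions = cartesianProduct (upTo m) (upTo m)

  patterns : List ((ℕ × ℕ) ⊎ (ℕ × ℕ))
  patterns = map inj₁ positions ++ map inj₂ positions

  inj₁∈patterns : ∀ {i j} → i < m → j < m → inj₁ (i , j) LM.∈ patterns
  inj₁∈patterns i< j< = ∈-++⁺ˡ (∈-map⁺ inj₁ (∈-cartesianProduct⁺ (∈-upTo⁺ i<) (∈-upTo⁺ j<)))

  inj₂∈patterns : ∀ {i j} → i < m → j < m → inj₂ (i , j) LM.∈ patterns
  inj₂∈patterns i< j< = ∈-++⁺ʳ (map inj₁ positions) (∈-map⁺ inj₂ (∈-cartesianProduct⁺ (∈-upTo⁺ i<) (∈-upTo⁺ j<)))

  module _ {n′ : ℕ} (G : Graph (suc n′)) (free : Free (oddCycle k 1≤k) G)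
    (dense : ∀ v → suc e * suc n′ ≤ (e * m) * degree G v) (order-bound<n : order-bound < suc n′) where

    n : ℕ
    n = suc n′

    N : Fin n → Subset n
    N = neighbourhood G

    record Close (c : ℕ) (x y : Fin n) : Set where
      constructor close
      field
        many-common : n ≤ c * ∣ N x ∩ N y ∣

    open Close

    Close? : ∀ c → Decidable₂ (Close c)
    Close? c x y = map′ close many-common (n ≤? c * ∣ N x ∩ N y ∣)

    Close-mono : ∀ {c d x y} → c ≤ d → Close c x y → Close d x y
    Close-mono c≤d (close h) = close (≤-trans h (*-monoˡ-≤ _ c≤d))

    Close-sym : ∀ {c x y} → Close c x y → Close c y x
    Close-sym {c} {x} {y} (close h) = close (subst (λ p → n ≤ c * ∣ p ∣) (Subₚ.∩-comm (N x) (N y)) h)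

    Close⇒common : ∀ {c x y b} .{{_ : NonZero c}} → c ≤ K₂ → b ≤ m + (R + 2 * suc k) → Close c x y → b < ∣ N x ∩ N y ∣
    Close⇒common {c} {b = b} c≤ b≤ (close h) = *-cancelˡ-< c b _
      (<-≤-trans (≤-<-trans (*-mono-≤ c≤ b≤) order-bound<n) h)

    close-pair : {A : Set} (f : A → Fin n) (xs : List A) → length xs ≡ m →
      ∃ λ x → ∃ λ y → (x ∷ y ∷ []) ⊆ xs × Close K (f x) (f y)
    close-pair f xs len = ¬AllPairs¬⇒pair (λ x y → Close? K (f x) (f y)) xs λ none →
      dense-family-intersects (N ∘ f) (suc e) (e * m) xs len em<m[1+e]
        (All.tabulate (λ {x} _ → dense (f x))) (AllPairs.map (λ ¬close → <⇒≤ (≰⇒> (¬close ∘ close))) none)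
      where
      lem : ∀ e m → e * m + m ≡ m * suc e
      lem = solve-∀
      em<m[1+e] : e * m < m * suc e
      em<m[1+e] = <-≤-trans (m<m+n (e * m) (s≤s z≤n)) (≤-reflexive (lem e m))

    -- Consecutive vertices of the list are linked through a common neighbour. The rest of the walk
    -- is built first, with w added to the forbidden list; the link u is then chosen outside
    -- everything used. The size hypothesis is the budget of vertices to be avoided.
    weave : ∀ y w ws B → AllPairs (Close K) (w ∷ ws) → Unique (w ∷ ws) → All (Adj G y) (w ∷ ws) → All (LM._∉ B) (w ∷ ws) →
      length B + 2 * suc (length ws) ≤ m + (R + 2 * suc k) →
      ∃ λ zs → ∃ λ z → Walk G w zs z × Adj G y z × length zs ≡ 1 + 2 * length ws × Unique zs × All (LM._∉ B) zs
    weave y w [] B _ _ (y~w ∷ _) (w∉B ∷ _) _ = w ∷ [] , w , [ w ] , y~w , refl , [] ∷ [] , w∉B ∷ []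
    weave y w (w′ ∷ ws) B ((cl ∷ _) ∷ cls) (w∉ws ∷ uniq) (_ ∷ y~ws) (w∉B ∷ ws∉B) size =
      let (zs , z , walk , y~z , len , uniq′ , zs∉) = weave y w′ ws (w ∷ B) cls uniq y~ws
            (All.zipWith (λ (w≢v , v∉B) → λ { (here v≡w) → w≢v (sym v≡w) ; (there v∈B) → v∉B v∈B }) (w∉ws , ws∉B))
            (≤-trans (n≤1+n _) (≤-trans (≤-reflexive (lem₁ (length B) (length ws))) size))
          len′ = cong suc (trans (length-++ B) (cong (length B +_) len))
          (u , u∈ , u∉) = element-avoiding (N w ∩ N w′) (w ∷ B ++ zs)
            (Close⇒common K≤K₂ (≤-trans (n≤1+n _) (≤-trans (n≤1+n _) (≤-trans (≤-reflexive (trans (cong (2 +_) len′) (lem₂ (length B) (length ws)))) size))) cl)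
          (u∈w , u∈w′) = x∈p∩q⁻ (N w) (N w′) u∈
      in w ∷ u ∷ zs , z
         , ∈-neighbourhood⁻ G u∈w ∷ Adj-sym G (∈-neighbourhood⁻ G u∈w′) ∷ walk
         , y~z
         , trans (cong (2 +_) len) (lem₃ (length ws))
         , ((λ w≡u → u∉ (here (sym w≡u))) ∷ All.map (λ v∉ w≡v → v∉ (here (sym w≡v))) zs∉)
           ∷ All.tabulate (λ v∈zs u≡v → u∉ (there (∈-++⁺ʳ B (subst (LM._∈ zs) (sym u≡v) v∈zs)))) ∷ uniq′
         , w∉B ∷ (λ u∈B → u∉ (there (∈-++⁺ˡ u∈B))) ∷ All.map (λ v∉ v∈B → v∉ (there v∈B)) zs∉
      where
      lem₁ : ∀ b l → suc (suc b + 2 * suc l) ≡ b + 2 * suc (suc l)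
      lem₁ = solve-∀
      lem₂ : ∀ b l → 2 + suc (b + (1 + 2 * l)) ≡ b + 2 * suc (suc l)
      lem₂ = solve-∀
      lem₃ : ∀ l → 2 + (1 + 2 * l) ≡ 1 + 2 * suc l
      lem₃ = solve-∀

    -- This is the interior of a path of length 2s + 2 from x to y. Ramsey among the common
    -- neighbours yields k + 1 pairwise close ones, and the first s + 1 are woven together; any of
    -- them may serve as an end, being adjacent to both x and y.
    detour : ∀ {x y} s B → s ≤ k → length B ≤ m → Close K₂ x y →
      ∃ λ w → ∃ λ zs → ∃ λ z → Adj G x w × Walk G w zs z × Adj G y z ×
        length zs ≡ 1 + 2 * s × Unique zs × All (LM._∉ B) zs
    detour {x} {y} s B s≤k B≤m cl
      with elements-avoiding (N x ∩ N y) B R (<⇒≤ (Close⇒common ≤-refl (+-mono-≤ B≤m (m≤m+n R _)) cl))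
    ... | vs , vs-len , vs-uniq , vs∈ , vs∉B with ramsey (Close? K) (suc k) m vs (≤-reflexive (sym vs-len))
    ...   | inj₂ (ws , _ , ws-len , none) =
      let (_ , _ , uv⊆ws , cl′) = close-pair id ws ws-len
      in contradiction cl′ (All.head (AllPairs.head (AllPairs-resp-⊆ uv⊆ws none)))
    ...   | inj₁ (w ∷ ws , ws⊆ , ws-len , clique) =
      let xw = All.head (All-resp-⊆ ws⊆ vs∈)
          len : length (take s ws) ≡ s
          len = trans (length-take s ws) (m≤n⇒m⊓n≡m (≤-trans s≤k (≤-reflexive (sym (suc-injective ws-len)))))
          (zs , z , walk , y~z , zs-len , zs-uniq , zs∉B) = weave y w (take s ws) B
            (AllPairsₚ.take⁺ (suc s) clique)
            (AllPairsₚ.take⁺ (suc s) (AllPairs-resp-⊆ ws⊆ vs-uniq))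
            (Allₚ.take⁺ (suc s) (All-resp-⊆ ws⊆ (All.map (λ v∈ → ∈-neighbourhood⁻ G (proj₂ (x∈p∩q⁻ (N x) (N y) v∈))) vs∈)))
            (Allₚ.take⁺ (suc s) (All-resp-⊆ ws⊆ vs∉B))
            (+-mono-≤ B≤m (≤-trans (*-monoʳ-≤ 2 (s≤s (≤-trans (≤-reflexive len) s≤k))) (m≤n+m _ R)))
      in w , zs , z , ∈-neighbourhood⁻ G (proj₁ (x∈p∩q⁻ (N x) (N y) xw)) , walk , y~z
         , trans zs-len (cong (λ t → 1 + 2 * t) len) , zs-uniq , zs∉B

    -- A detour with 2s + 1 inner vertices that avoids the walk closes it to a cycle on 2k + 1
    -- vertices.
    close-ends⇒⊥ : ∀ {x xs y} s → Walk G x xs y → Unique xs → Close K₂ y x → length xs + 2 * s ≡ 2 * k → ⊥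
    close-ends⇒⊥ {x} {xs} s walk uniq cl len =
      let (w , zs , z , y~w , walk′ , x~z , zs-len , zs-uniq , zs∉) = detour s xs
            (*-cancelˡ-≤ 2 (≤-trans (m≤n+m _ (length xs)) (≤-reflexive len)))
            (≤-trans (m≤m+n _ _) (≤-trans (≤-reflexive len) (n≤1+n _))) cl
      in free (closedWalk⇒cycle (s≤s (*-monoʳ-≤ 2 1≤k))
        (trans (length-++ xs) (trans (cong (length xs +_) zs-len) (trans (+-suc _ _) (cong suc len))))
        (Walk-++ walk y~w walk′) (Adj-sym G x~z)
        (Uniqueₚ.++⁺ uniq zs-uniq (λ (v∈xs , v∈zs) → All.lookup zs∉ v∈zs v∈xs)))

    segment : ∀ {x y} → Path G (2 * k) x y → ℕ → ℕ → List (Fin n)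
    segment P a l = applyUpTo (λ i → vertex P (a + i)) (suc l)

    module _ {x y : Fin n} (P : Path G (2 * k) x y) {a l : ℕ} (a+l≤2k : a + l ≤ 2 * k) where

      segment-Walk : Walk G (vertex P a) (segment P a l) (vertex P (a + l))
      segment-Walk = subst (λ t → Walk G (vertex P t) (segment P a l) (vertex P (a + l))) (+-identityʳ a)
        (Walk-applyUpTo (λ i → vertex P (a + i)) l λ r r<l →
          subst (λ t → Adj G (vertex P (a + r)) (vertex P t)) (sym (+-suc a r))
            (step P (a + r) (<-≤-trans (+-monoʳ-< a r<l) a+l≤2k)))

      segment-Unique : Unique (segment P a l)
      segment-Unique = Uniqueₚ.applyUpTo⁺₁ _ (suc l) λ i<j j≤l →
        distinct P (+-monoʳ-< a i<j) (≤-trans (+-monoʳ-≤ a (s≤s⁻¹ j≤l)) a+l≤2k)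

    -- Two of the 2k + 1 vertices of the path are close. Their distance along the path is even, for
    -- otherwise a detour would complete the segment between them to a forbidden cycle.
    path-close-pair : ∀ {x y} (P : Path G (2 * k) x y) →
      ∃ λ a → ∃ λ t → a + 2 * suc t ≤ 2 * k × Close K (vertex P a) (vertex P (a + 2 * suc t))
    path-close-pair P with close-pair (vertex P) (upTo m) (length-applyUpTo id m)
    ... | a , b , ab⊆ , cl
      with All-resp-⊆ ab⊆ (Allₚ.all-upTo m) | AllPairs-resp-⊆ ab⊆ (AllPairsₚ.applyUpTo⁺₁ {R = _<_} id m (λ i<j _ → i<j))
    ...   | _ ∷ b<m ∷ [] | (a<b ∷ []) ∷ _ with m≤n⇒∃[o]m+o≡n a<b
    ...     | d , refl with even⊎odd d
    ...       | t , inj₂ refl = a , t , subst (_≤ 2 * k) (lem a t) (s≤s⁻¹ b<m) , subst (λ b → Close K (vertex P a) (vertex P b)) (lem a t) cl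
      where
      lem : ∀ a t → suc a + (1 + 2 * t) ≡ a + 2 * suc t
      lem = solve-∀
    -- The distance is 1 + 2t, so the segment has 2 + 2t vertices; s = k - t - 1 leaves 2s + 1
    -- vertices for the detour.
    ...       | t , inj₁ refl =
      let b≡ = lem₁ a t
          b≤2k = subst (_≤ 2 * k) b≡ (s≤s⁻¹ b<m)
          (s , t+s) = m≤n⇒∃[o]m+o≡n {suc t} {k} (*-cancelˡ-< 2 t k (≤-trans (m≤n+m (1 + 2 * t) a) b≤2k))
      in ⊥-elim (close-ends⇒⊥ s (segment-Walk P {a} {1 + 2 * t} b≤2k) (segment-Unique P {a} {1 + 2 * t} b≤2k)
           (Close-sym (Close-mono K≤K₂ (subst (λ b → Close K (vertex P a) (vertex P b)) b≡ cl)))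
           (trans (cong (_+ 2 * s) (length-applyUpTo (λ i → vertex P (a + i)) (2 + 2 * t))) (trans (lem₂ t s) (cong (2 *_) t+s))))
      where
      lem₁ : ∀ a t → suc a + 2 * t ≡ a + (1 + 2 * t)
      lem₁ = solve-∀
      lem₂ : ∀ t s → 2 + 2 * t + 2 * s ≡ 2 * (suc t + s)
      lem₂ = solve-∀

    -- The path is what remains of the cycle that the edge from `source` to `target` would create.
    -- The condition `others` supplies the edges that link different blocked pairs.
    record BlockedPair (T : Subset n) : Set where
      field
        source target : Fin n
        target∈T      : target ∈ T
        others        : ∀ {t} → t ∈ T → t ≢ target → Adj G source t
        path          : Path G (2 * k) source target

      vertexAt : ℕ → Fin n
      vertexAt = vertex path

    open BlockedPair

    module _ {T : Subset n} where

      -- The second kind is a property of J alone, written as a relation so that one application of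
      -- Ramsey treats both kinds. Homogeneity then concerns every member of the list except the
      -- first.
      Pattern : (ℕ × ℕ) ⊎ (ℕ × ℕ) → BlockedPair T → BlockedPair T → Set
      Pattern (inj₁ (i , j)) I J = vertexAt I i ≡ vertexAt J j
      Pattern (inj₂ (a , b)) I J = Close K (vertexAt J a) (vertexAt J b)

      Pattern? : ∀ p → Decidable₂ (Pattern p)
      Pattern? (inj₁ (i , j)) I J = vertexAt I i Finₚ.≟ vertexAt J j
      Pattern? (inj₂ (a , b)) I J = Close? K (vertexAt J a) (vertexAt J b)

      splice⇒⊥ : ∀ {I J : BlockedPair T} {a} t → target I ≢ target J →
        (∀ {i j} → i < j → j ≤ 2 * k → vertexAt I i ≢ vertexAt J j) →
        a + 2 * suc t ≤ 2 * k → Close K₂ (vertexAt I a) (vertexAt J (a + 2 * suc t)) → ⊥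
      splice⇒⊥ {I} {J} {a} t I≢J apart b≤2k cl with m≤n⇒∃[o]m+o≡n b≤2k
      ... | c , b+c≡2k = close-ends⇒⊥ t
        (Walk-++ (segment-Walk PJ b+c≤2k) link (segment-Walk PI a≤2k))
        (Uniqueₚ.++⁺ (segment-Unique PJ b+c≤2k) (segment-Unique PI a≤2k) disjoint)
        cl
        (trans (cong (_+ 2 * t) (trans (length-++ (segment PJ b c))
          (cong₂ _+_ (length-applyUpTo (λ i → vertex PJ (b + i)) (suc c)) (length-applyUpTo (vertex PI) (suc a)))))
          (trans (lem a t c) b+c≡2k))
        where
        b = a + 2 * suc t
        PI = path I
        PJ = path J
        b+c≤2k : b + c ≤ 2 * k
        b+c≤2k = ≤-reflexive b+c≡2k
        a≤2k : a ≤ 2 * k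
        a≤2k = ≤-trans (m≤m+n a _) b≤2k
        a<b : a < b
        a<b = m<m+n a (s≤s z≤n)
        link : Adj G (vertex PJ (b + c)) (vertex PI 0)
        link = subst₂ (Adj G) (sym (trans (cong (vertex PJ) b+c≡2k) (end PJ))) (sym (start PI))
          (Adj-sym G (others I (target∈T J) (I≢J ∘ sym)))
        disjoint : ∀ {v} → ¬ (v LM.∈ segment PJ b c × v LM.∈ segment PI 0 a)
        disjoint (v∈J , v∈I) with ∈-applyUpTo⁻ _ v∈J | ∈-applyUpTo⁻ _ v∈I
        ... | j , j<1+c , v≡J | i , i<1+a , v≡I =
          apart (≤-trans i<1+a (≤-trans a<b (m≤m+n b j)))
            (≤-trans (+-monoʳ-≤ b (s≤s⁻¹ j<1+c)) b+c≤2k) (trans (sym v≡I) v≡J)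
        lem : ∀ a t c → suc c + suc a + 2 * t ≡ a + 2 * suc t + c
        lem = solve-∀

      -- Positions i of I and J both carry the j-th vertex of L, and position i of I also carries
      -- the j-th vertex of J; so J would repeat a vertex.
      coincidence⇒⊥ : ∀ {i j} {I J L : BlockedPair T} → i < j → j ≤ 2 * k →
        AllPairs (Pattern (inj₁ (i , j))) (I ∷ J ∷ L ∷ []) → ⊥
      coincidence⇒⊥ {J = J} i<j j≤2k ((I~J ∷ I~L ∷ []) ∷ (J~L ∷ []) ∷ _) =
        distinct (path J) i<j j≤2k (trans J~L (trans (sym I~L) I~J))

    few-blocked-pairs : ∀ {T} (Is : List (BlockedPair T)) → AllPairs (λ I J → target I ≢ target J) Is →
      length Is < multiRamseyNumber (length patterns) (2 + K)
    few-blocked-pairs {T} Is targets = ≰⇒> absurd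
      where
      common : ℕ → ℕ → BlockedPair T → Subset n
      common a t I = N (vertexAt I a) ∩ N (vertexAt I (a + 2 * suc t))

      module _ (h : multiRamseyNumber (length patterns) (2 + K) ≤ length Is) where
        absurd : ⊥
        absurd with multiRamsey Pattern? patterns (2 + K) Is h
        -- `I₀` is spare: it comes before every other member, so it makes the one-path patterns
        -- apply to all of them, and it is the third path in `coincidence⇒⊥`. The other 1 + K are
        -- the family to be intersected.
        ... | I₀ ∷ I₁ ∷ Is′ , sub , len , hom with path-close-pair (path I₁)
        ...   | a , t , b≤2k , cl
          with All.lookup hom (inj₂∈patterns (s≤s (≤-trans (m≤m+n a _) b≤2k)) (s≤s b≤2k))
        ...     | inj₂ ((¬cl ∷ _) ∷ _) = ¬cl cl
        ...     | inj₁ (all-close ∷ _)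
          -- The common neighbourhoods have density at least 1 / K, so two of the 1 + K meet in at
          -- least n / `K₂` vertices. These are adjacent to position a of I and to position b of J,
          -- which makes those two close.
          with ¬AllPairs¬⇒pair (λ I J → n ≤? K₂ * ∣ common a t I ∩ common a t J ∣) (I₁ ∷ Is′)
            (λ none → dense-family-intersects (common a t) 1 K (I₁ ∷ Is′) (suc-injective len)
              (≤-reflexive (sym (*-identityʳ (suc K))))
              (All.map (λ (close c) → ≤-trans (≤-reflexive (*-identityˡ n)) c) all-close)
              (AllPairs.map (<⇒≤ ∘ ≰⇒>) none))
        ...       | I , J , IJ⊆ , big = splice⇒⊥ {I = I} {J} {a} t
          (All.head (AllPairs.head (AllPairs-resp-⊆ (⊆-trans (I₀ ∷ʳ IJ⊆) sub) targets)))
          (λ i<j j≤2k → apart i<j j≤2k (All.lookup hom (inj₁∈patterns (<-≤-trans i<j (≤-trans j≤2k (n≤1+n _))) (s≤s j≤2k))))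
          b≤2k
          (close (≤-trans big (*-monoʳ-≤ K₂ (p⊆q⇒∣p∣≤∣q∣ common∩common⊆))))
          where
          apart : ∀ {i j} → i < j → j ≤ 2 * k → Homogeneous (Pattern (inj₁ (i , j))) (I₀ ∷ I₁ ∷ Is′) → vertexAt I i ≢ vertexAt J j
          apart i<j j≤2k (inj₁ all) = ⊥-elim (coincidence⇒⊥ i<j j≤2k (AllPairs-resp-⊆ (refl ∷ IJ⊆) all))
          apart i<j j≤2k (inj₂ none) = All.head (AllPairs.head (AllPairs-resp-⊆ (I₀ ∷ʳ IJ⊆) none))
          common∩common⊆ : common a t I ∩ common a t J
            Sub.⊆ N (vertexAt I a) ∩ N (vertexAt J (a + 2 * suc t))
          common∩common⊆ x∈ = let (x∈I , x∈J) = x∈p∩q⁻ (common a t I) (common a t J) x∈ in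
            x∈p∩q⁺ (proj₁ (x∈p∩q⁻ _ (N (vertexAt I (a + 2 * suc t))) x∈I) , proj₂ (x∈p∩q⁻ (N (vertexAt J a)) _ x∈J))

  -- Blocked pairs from a shattered set

  D : ℕ
  D = multiRamseyNumber (length patterns) (2 + K)

  -- One element z of S is set aside, and each of the others becomes the target of a blocked pair.
  -- The summand `order-bound` makes the graph large, and `suc D` leaves D targets after the removal
  -- of z.
  shattered-bound : ∀ {n′} (G : Graph (suc n′)) → MaximalFree (oddCycle k 1≤k) G →
    (∀ v → suc e * suc n′ ≤ (e * m) * degree G v) →
    ∀ S → Shattered G S → ∣ S ∣ ≤ order-bound + suc D
  shattered-bound {n′} G (free , maximal) dense S shattered = ≮⇒≥ absurd
    where
    absurd : ¬ (order-bound + suc D < ∣ S ∣)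
    absurd large with 0<∣p∣⇒Nonempty S (≤-trans (s≤s z≤n) large)
    ... | z , z∈S = <⇒≱ (few-blocked-pairs G free dense order-bound<n (proj₁ blocked) distinct-targets) enough
      where
      order-bound<n : order-bound < suc n′
      order-bound<n = ≤-trans (s≤s (m≤m+n order-bound _)) (≤-trans large (∣p∣≤n S))

      S′ : Subset (suc n′)
      S′ = S ∩ ∁ ⁅ z ⁆

      Blocked : Set
      Blocked = BlockedPair G free dense order-bound<n S′

      module _ {s : Fin (suc n′)} (s∈S′ : s ∈ S′) where

        s≢z : s ≢ z
        s≢z s≡z = x∈∁p⇒x∉p (proj₂ (x∈p∩q⁻ S _ s∈S′)) (subst (_∈ ⁅ z ⁆) (sym s≡z) (x∈⁅x⁆ z))

        -- The two inclusions cover the traces S - s and S - s - z together: each omits s and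
        -- contains the rest of `S′`.
        blockedBy : ∀ {A v} → A Sub.⊆ S ∩ ∁ ⁅ s ⁆ → S′ ∩ ∁ ⁅ s ⁆ Sub.⊆ A → neighbourhood G v ∩ S ≡ A → v ≢ s →
          Σ Blocked λ I → BlockedPair.target I ≡ s
        blockedBy {A} {v} A⊆ ⊆A trace v≢s = record
          { source   = v
          ; target   = s
          ; target∈T = s∈S′
          ; others   = λ {t} t∈S′ t≢s → ∈-neighbourhood⁻ G (proj₁ (x∈p∩q⁻ (neighbourhood G v) S
              (subst (t ∈_) (sym trace) (⊆A (x∈p∩q⁺ (t∈S′ , x∉p⇒x∈∁p (t≢s ∘ x∈⁅y⁆⇒x≡y s)))))))
          ; path     = let (f , inj , hom) = maximal v s v≢s v≁s in addEdge⇒Path 3≤m v≢s f inj hom free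
          } , refl
          where
          v≁s : ¬ Adj G v s
          v≁s e = x∈∁p⇒x∉p (proj₂ (x∈p∩q⁻ S _ (A⊆ (subst (s ∈_) trace
            (x∈p∩q⁺ (∈-neighbourhood⁺ G e , proj₁ (x∈p∩q⁻ S _ s∈S′))))))) (x∈⁅x⁆ s)

        ⊆S-s : S′ ∩ ∁ ⁅ s ⁆ Sub.⊆ S ∩ ∁ ⁅ s ⁆
        ⊆S-s x∈ = let (x∈S′ , x∉s) = x∈p∩q⁻ S′ _ x∈ in x∈p∩q⁺ (p∩q⊆p S _ x∈S′ , x∉s)

        -- The traces S - s and S - s - z have different witnesses, so one of them is not s.
        block : Σ Blocked λ I → BlockedPair.target I ≡ s
        block with shattered (S ∩ ∁ ⁅ s ⁆) (p∩q⊆p S _) | shattered (S′ ∩ ∁ ⁅ s ⁆) (p∩q⊆p S _ ∘ p∩q⊆p S′ _)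
        ... | v , v-trace | w , w-trace with v Finₚ.≟ s | w Finₚ.≟ s
        ...   | no v≢s  | _        = blockedBy id ⊆S-s v-trace v≢s
        ...   | yes _   | no w≢s   = blockedBy ⊆S-s id w-trace w≢s
        ...   | yes v≡s | yes w≡s  = contradiction (x∈⁅x⁆ z)
          (x∈∁p⇒x∉p (proj₂ (x∈p∩q⁻ S _ (p∩q⊆p S′ _ (subst (z ∈_)
            (trans (sym v-trace) (trans (cong (λ u → neighbourhood G u ∩ S) (trans v≡s (sym w≡s))) w-trace)) z∈S-s)))))
          where
          z∈S-s : z ∈ S ∩ ∁ ⁅ s ⁆
          z∈S-s = x∈p∩q⁺ (z∈S , x∉p⇒x∈∁p (s≢z ∘ sym ∘ x∈⁅y⁆⇒x≡y s))

      blockAll : ∀ {ss} → All (_∈ S′) ss → Σ (List Blocked) λ Is → map BlockedPair.target Is ≡ ss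
      blockAll []          = [] , refl
      blockAll (s∈S′ ∷ ss∈) =
        let (I , eq) = block s∈S′ ; (Is , eqs) = blockAll ss∈ in I ∷ Is , cong₂ _∷_ eq eqs

      targets = elements-avoiding S′ [] ∣ S′ ∣ ≤-refl
      blocked = blockAll (proj₁ (proj₂ (proj₂ (proj₂ targets))))

      distinct-targets : AllPairs (λ I J → BlockedPair.target I ≢ BlockedPair.target J) (proj₁ blocked)
      distinct-targets = AllPairsₚ.map⁻ (subst Unique (sym (proj₂ blocked)) (proj₁ (proj₂ (proj₂ targets))))

      enough : D ≤ length (proj₁ blocked)
      enough = begin
        D                                             ≤⟨ s≤s⁻¹ (≤-trans (≤-trans (m≤n+m (suc D) order-bound) (<⇒≤ large)) (∣p∣≤1+∣p∩∁⁅x⁆∣ S z)) ⟩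
        ∣ S′ ∣                                         ≡⟨ proj₁ (proj₂ targets) ⟨
        length (proj₁ targets)                        ≡⟨ cong length (proj₂ blocked) ⟨
        length (map BlockedPair.target (proj₁ blocked)) ≡⟨ length-map BlockedPair.target (proj₁ blocked) ⟩
        length (proj₁ blocked)                        ∎
        where open ≤-Reasoning

-- Closed walks of length 2k+1 in a cycle of length 2k+1

module _ {F B : ℕ → Set} (dir : ∀ i → F i ⊎ B i) where

  forwardSteps : ℕ → ℕ
  forwardSteps zero    = 0
  forwardSteps (suc i) with dir i
  ... | inj₁ _ = suc (forwardSteps i)
  ... | inj₂ _ = forwardSteps i

  forwardSteps≤ : ∀ i → forwardSteps i ≤ i
  forwardSteps≤ zero    = z≤n
  forwardSteps≤ (suc i) with dir i
  ... | inj₁ _ = s≤s (forwardSteps≤ i)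
  ... | inj₂ _ = m≤n⇒m≤1+n (forwardSteps≤ i)

  forwardSteps≡⇒forward : ∀ n → forwardSteps n ≡ n → ∀ i → i < n → F i
  forwardSteps≡⇒forward (suc n) eq i i<n with dir n
  ... | inj₂ _ = contradiction (≤-trans (≤-reflexive (sym eq)) (forwardSteps≤ n)) 1+n≰n
  ... | inj₁ f with m≤n⇒m<n∨m≡n (s≤s⁻¹ i<n)
  ...   | inj₁ i<n′ = forwardSteps≡⇒forward n (suc-injective eq) i i<n′
  ...   | inj₂ refl = f

  forwardSteps≡0⇒backward : ∀ n → forwardSteps n ≡ 0 → ∀ i → i < n → B i
  forwardSteps≡0⇒backward (suc n) eq i i<n with dir n
  ... | inj₂ b with m≤n⇒m<n∨m≡n (s≤s⁻¹ i<n)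
  ...   | inj₁ i<n′ = forwardSteps≡0⇒backward n eq i i<n′
  ...   | inj₂ refl = b

  module _ (k : ℕ) (c : ℕ → ℕ) (F⇒ : ∀ i → F i → suc (c i) % suc (2 * k) ≡ c (suc i))
    (B⇒ : ∀ i → B i → suc (c (suc i)) % suc (2 * k) ≡ c i) where

    private
      m : ℕ
      m = suc (2 * k)

      carry : ∀ {x y} → suc x % m ≡ y → suc x ≡ y + (suc x DivMod./ m) * m
      carry {x} eq = trans (m≡m%n+[m/n]*n (suc x) m) (cong (_+ (suc x DivMod./ m) * m) eq)

    -- Modulo m, the position after i steps of which u are forward is c 0 + 2u - i.
    position : ∀ i → ∃ λ a → ∃ λ b → c i + i + a * m ≡ c 0 + 2 * forwardSteps i + b * m
    position zero    = 0 , 0 , refl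
    position (suc i) with position i | dir i
    ... | a , b , eq | inj₁ f = a + suc (c i) DivMod./ m , b , (begin
      c (suc i) + suc i + (a + q) * m           ≡⟨ lem₁ (c (suc i)) i a q m ⟩
      suc ((c (suc i) + q * m) + i + a * m)     ≡⟨ cong (λ t → suc (t + i + a * m)) (sym (carry (F⇒ i f))) ⟩
      suc (suc (c i) + i + a * m)               ≡⟨ cong (2 +_) eq ⟩
      2 + (c 0 + 2 * forwardSteps i + b * m)    ≡⟨ lem₂ (c 0) (forwardSteps i) (b * m) ⟩
      c 0 + 2 * suc (forwardSteps i) + b * m    ∎)
      where
      open ≡-Reasoning
      q : ℕ
      q = suc (c i) DivMod./ m
      lem₁ : ∀ x i a q m → x + suc i + (a + q) * m ≡ suc ((x + q * m) + i + a * m)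
      lem₁ = solve-∀
      lem₂ : ∀ x u y → 2 + (x + 2 * u + y) ≡ x + 2 * suc u + y
      lem₂ = solve-∀
    ... | a , b , eq | inj₂ g = a , b + q , (begin
      c (suc i) + suc i + a * m                 ≡⟨ cong (_+ a * m) (+-suc (c (suc i)) i) ⟩
      suc (c (suc i)) + i + a * m               ≡⟨ cong (λ t → t + i + a * m) (carry (B⇒ i g)) ⟩
      c i + q * m + i + a * m                   ≡⟨ lem₁ (c i) (q * m) i (a * m) ⟩
      (c i + i + a * m) + q * m                 ≡⟨ cong (_+ q * m) eq ⟩
      c 0 + 2 * forwardSteps i + b * m + q * m  ≡⟨ lem₂ (c 0 + 2 * forwardSteps i) b q m ⟩
      c 0 + 2 * forwardSteps i + (b + q) * m    ∎)
      where
      open ≡-Reasoning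
      q : ℕ
      q = suc (c (suc i)) DivMod./ m
      lem₁ : ∀ x y i z → x + y + i + z ≡ (x + i + z) + y
      lem₁ = solve-∀
      lem₂ : ∀ x b q m → x + b * m + q * m ≡ x + (b + q) * m
      lem₂ = solve-∀

    -- Here the oddness of m enters: (2k + 1) u = k (2u) + u.
    m∣2u⇒m∣u : ∀ u → m Div.∣ 2 * u → m Div.∣ u
    m∣2u⇒m∣u u h = ∣m+n∣m⇒∣n (subst (m Div.∣_) (lem k u) (m∣m*n u)) (∣m⇒∣m*n k h)
      where
      lem : ∀ k u → suc (2 * k) * u ≡ 2 * u * k + u
      lem = solve-∀

    m∣forwardSteps : c m ≡ c 0 → m Div.∣ forwardSteps m
    m∣forwardSteps closed with position m
    ... | a , b , eq = m∣2u⇒m∣u (forwardSteps m) (∣m+n∣m⇒∣n (divides (suc a) (+-cancelˡ-≡ (c 0) _ _ (begin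
      c 0 + (b * m + 2 * forwardSteps m)  ≡⟨ lem (c 0) (forwardSteps m) (b * m) ⟩
      c 0 + 2 * forwardSteps m + b * m    ≡⟨ eq ⟨
      c m + m + a * m                     ≡⟨ cong (λ t → t + m + a * m) closed ⟩
      c 0 + m + a * m                     ≡⟨ +-assoc (c 0) m (a * m) ⟩
      c 0 + suc a * m                     ∎))) (n∣m*n b))
      where
      open ≡-Reasoning
      lem : ∀ x u y → x + (y + 2 * u) ≡ x + 2 * u + y
      lem = solve-∀

    -- A closed walk of m steps, u of them forward, has 2u divisible by m, hence u divisible by m;
    -- as u is at most m, it is 0 or m.
    closed⇒monotone : c m ≡ c 0 → (∀ i → i < m → F i) ⊎ (∀ i → i < m → B i)
    closed⇒monotone closed with m∣forwardSteps closed
    ... | divides zero    u≡ = inj₂ (forwardSteps≡0⇒backward m u≡)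
    ... | divides (suc q) u≡ = inj₁ (forwardSteps≡⇒forward m
      (≤-antisym (forwardSteps≤ m) (≤-trans (m≤m+n m (q * m)) (≤-reflexive (sym u≡)))))

-- A graph of minimum degree close to n/(2k+1) with a large shattered set

module LowerBound (k : ℕ) (1≤k : 1 ≤ k) (d N : ℕ) where

  l m q : ℕ
  l = 2 * k
  m = suc l
  q = 2 ^ suc d * suc d

  1<l : 1 < l
  1<l = *-monoʳ-≤ 2 1≤k

  l≢0 : l ≢ 0
  l≢0 = >⇒≢ (<-trans (s≤s z≤n) 1<l)

  1+pred[l]≡l : suc (pred l) ≡ l
  1+pred[l]≡l = suc-pred l {{>-nonZero (<-trans (s≤s z≤n) 1<l)}}

  -- The first component encodes a subset of Fin (suc d).
  Core : Set
  Core = Fin (2 ^ suc d) × Fin (suc d)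

  Label : Set
  Label = Fin (suc N) ⊎ Core

  _∈ᶜ_ : Fin (suc d) → Fin (2 ^ suc d) → Set
  s ∈ᶜ A = finToFun {2} A s ≡ suc zero

  ∅ᶜ : Fin (2 ^ suc d)
  ∅ᶜ = funToFin {suc d} {2} (λ _ → zero)

  -- Edges from colour c to colour c + 1.  The vertices inj₁ of colour c + 1 form a large class
  -- joined to the core vertices inj₂ of colour c; consecutive large classes are joined, except
  -- across c = 0, where the cyclic order of colours is cut.
  Link : ℕ → Label → Label → Set
  Link c (inj₁ _)       (inj₁ _)         = c ≢ 0
  Link c (inj₁ _)       (inj₂ _)         = ⊥
  Link c (inj₂ _)       (inj₁ _)         = ⊤
  Link c (inj₂ (A , s)) (inj₂ (A′ , s′)) =
    (c ≡ 0 → A ≡ A′ × ¬ s′ ∈ᶜ A′) × (c ≢ 0 → c ≢ l → s ≡ s′) × (c ≡ l → s ∈ᶜ A′)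

  Link? : ∀ c → Decidable₂ (Link c)
  Link? c (inj₁ _)       (inj₁ _)         = ¬? (c ≟ 0)
  Link? c (inj₁ _)       (inj₂ _)         = no id
  Link? c (inj₂ _)       (inj₁ _)         = yes tt
  Link? c (inj₂ (A , s)) (inj₂ (A′ , s′)) =
    (c ≟ 0 →-dec (A Finₚ.≟ A′ ×-dec ¬? (finToFun A′ s′ Finₚ.≟ suc zero)))
    ×-dec (¬? (c ≟ 0) →-dec (¬? (c ≟ l) →-dec s Finₚ.≟ s′))
    ×-dec (c ≟ l →-dec finToFun A′ s Finₚ.≟ suc zero)

  Vertex : Set
  Vertex = Fin m × Label

  Forward : Vertex → Vertex → Set
  Forward (c , x) (c′ , x′) = suc (toℕ c) % m ≡ toℕ c′ × Link (toℕ c) x x′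

  Forward? : Decidable₂ Forward
  Forward? (c , x) (c′ , x′) = suc (toℕ c) % m ≟ toℕ c′ ×-dec Link? (toℕ c) x x′

  Forward-irrefl : ∀ v → ¬ Forward v v
  Forward-irrefl (c , x) (eq , _) = contradiction
    (trans (sym (adj-irrefl (cycle m (s≤s 1<l)) c)) (Equivalence.to T-≡ (cycle-Adj⁺ (s≤s 1<l) eq))) λ ()

  n′ : ℕ
  n′ = (N + q) + l * (suc N + q)

  encode : Vertex → Fin (suc n′)
  encode (c , inj₁ x)       = combine c (join (suc N) q (inj₁ x))
  encode (c , inj₂ (A , s)) = combine c (join (suc N) q (inj₂ (combine A s)))

  decodeLabel : Fin (suc N) ⊎ Fin q → Label
  decodeLabel (inj₁ x) = inj₁ x
  decodeLabel (inj₂ y) = inj₂ (remQuot (suc d) y)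

  decode : Fin (suc n′) → Vertex
  decode v = let (c , x) = remQuot {m} (suc N + q) v in c , decodeLabel (splitAt (suc N) x)

  decode-encode : ∀ v → decode (encode v) ≡ v
  decode-encode (c , inj₁ x) = begin
    decode (encode (c , inj₁ x))
      ≡⟨ cong (λ (c , x) → c , decodeLabel (splitAt (suc N) x)) (remQuot-combine c (join (suc N) q (inj₁ x))) ⟩
    (c , decodeLabel (splitAt (suc N) (join (suc N) q (inj₁ x))))
      ≡⟨ cong (λ y → c , decodeLabel y) (splitAt-join (suc N) q (inj₁ x)) ⟩
    (c , inj₁ x) ∎
    where open ≡-Reasoning
  decode-encode (c , inj₂ (A , s)) = begin
    decode (encode (c , inj₂ (A , s)))
      ≡⟨ cong (λ (c , x) → c , decodeLabel (splitAt (suc N) x)) (remQuot-combine c (join (suc N) q (inj₂ (combine A s)))) ⟩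
    (c , decodeLabel (splitAt (suc N) (join (suc N) q (inj₂ (combine A s)))))
      ≡⟨ cong (λ y → c , decodeLabel y) (splitAt-join (suc N) q (inj₂ (combine A s))) ⟩
    (c , inj₂ (remQuot (suc d) (combine A s)))
      ≡⟨ cong (λ y → c , inj₂ y) (remQuot-combine A s) ⟩
    (c , inj₂ (A , s)) ∎
    where open ≡-Reasoning

  encode-injective : ∀ u v → encode u ≡ encode v → u ≡ v
  encode-injective u v eq = trans (sym (decode-encode u)) (trans (cong decode eq) (decode-encode v))

  G₀ : Graph (suc n′)
  G₀ = record
    { adj        = λ u v → forward u v ∨ forward v u
    ; adj-sym    = λ u v → ∨-comm (forward u v) (forward v u)
    ; adj-irrefl = λ v → cong₂ _∨_ (forward-irrefl v) (forward-irrefl v)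
    }
    where
    forward : Fin (suc n′) → Fin (suc n′) → Bool
    forward u v = does (Forward? (decode u) (decode v))

    forward-irrefl : ∀ v → forward v v ≡ false
    forward-irrefl v = dec-false (Forward? (decode v) (decode v)) (Forward-irrefl (decode v))

  G₀-Adj⁻ : ∀ u v → Adj G₀ u v → Forward (decode u) (decode v) ⊎ Forward (decode v) (decode u)
  G₀-Adj⁻ u v h with Equivalence.to (T-∨ {does (Forward? (decode u) (decode v))}) h
  ... | inj₁ f = inj₁ (does⇒ (Forward? (decode u) (decode v)) f)
  ... | inj₂ b = inj₂ (does⇒ (Forward? (decode v) (decode u)) b)

  G₀-Adj⁺ : ∀ u v → Forward (decode u) (decode v) → Adj G₀ u v
  G₀-Adj⁺ u v h = Equivalence.from (T-∨ {does (Forward? (decode u) (decode v))}) (inj₁ (⇒does (Forward? (decode u) (decode v)) h))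

  encode-Adj : ∀ u v → Forward u v → Adj G₀ (encode u) (encode v)
  encode-Adj u v h = G₀-Adj⁺ (encode u) (encode v) (subst₂ Forward (sym (decode-encode u)) (sym (decode-encode v)) h)

  -- The links at colour 0 make the first label a core label, and no link leads from a large class
  -- to the core, so all labels are core. The link at 0 keeps A and picks an element outside A, the
  -- later links keep that element, and the link at l requires it to lie in A.
  no-labelled-cycle : (x : ℕ → Label) → (∀ j → j ≤ l → Link j (x j) (x (suc j))) → x m ≡ x 0 → ⊥
  no-labelled-cycle x link closed = absurd (core (suc l) 0 z≤n refl) (core l 1 (s≤s z≤n) refl)
    where
    IsCore : Label → Set
    IsCore x = ∃ λ y → x ≡ inj₂ y
    start-core : IsCore (x 0)
    start-core with x 0 | x 1 | link 0 z≤n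
    ... | inj₁ _ | inj₁ _ | 0≢0 = contradiction refl 0≢0
    ... | inj₁ _ | inj₂ _ | ()
    ... | inj₂ y | _      | _   = y , refl
    core : ∀ r j → j ≤ m → j + r ≡ m → IsCore (x j)
    core zero    j j≤ eq = subst (IsCore ∘ x) (trans (sym eq) (+-identityʳ j)) (subst IsCore (sym closed) start-core)
    core (suc r) j j≤ eq with core r (suc j) (≤-trans (s≤s (m≤m+n j r)) (≤-reflexive (trans (sym (+-suc j r)) eq))) (trans (sym (+-suc j r)) eq)
    ... | y , xj+1 with x j | link j (s≤s⁻¹ (≤-trans (s≤s (m≤m+n j r)) (≤-reflexive (trans (sym (+-suc j r)) eq))))
    ...   | inj₂ z | _ = z , refl
    ...   | inj₁ _ | e rewrite xj+1 = ⊥-elim e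
    module _ {j A s A′ s′} (j≤l : j ≤ l) (xj : x j ≡ inj₂ (A , s)) (xj+1 : x (suc j) ≡ inj₂ (A′ , s′)) where
      coreLink : Link j (inj₂ (A , s)) (inj₂ (A′ , s′))
      coreLink = subst₂ (Link j) xj xj+1 (link j j≤l)
    element-const : ∀ j {A s} → x 1 ≡ inj₂ (A , s) → suc j ≤ l → ∃ λ A′ → x (suc j) ≡ inj₂ (A′ , s)
    element-const zero    {A} eq _  = A , eq
    element-const (suc j) eq j<l
      with element-const j eq (<⇒≤ j<l) | core (l ∸ suc j) (suc (suc j)) (s≤s (<⇒≤ j<l)) (cong suc (m+[n∸m]≡n (<⇒≤ j<l)))
    ... | _ , eq′ | (A , s) , eq″ with proj₁ (proj₂ (coreLink (<⇒≤ j<l) eq′ eq″)) (λ ()) (<⇒≢ j<l)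
    ...   | refl = A , eq″
    absurd : IsCore (x 0) → IsCore (x 1) → ⊥
    absurd ((A , s) , x0) ((A₁ , s₁) , x1)
      with proj₁ (coreLink z≤n x0 x1) refl | element-const (pred l) x1 (≤-reflexive 1+pred[l]≡l)
    ... | refl , s₁∉A | _ , xl =
      s₁∉A (proj₂ (proj₂ (coreLink ≤-refl (trans (cong x (sym 1+pred[l]≡l)) xl) (trans closed x0))) refl)

  no-forward-walk : (x : ℕ → Vertex) → (∀ i → Forward (x i) (x (suc i))) → (∀ i j → i % m ≡ j % m → x i ≡ x j) → ⊥
  no-forward-walk x forward periodic = no-labelled-cycle (λ j → proj₂ (x (i₀ + j)))
    (λ j j≤l → subst₂ (λ c t → Link c (proj₂ (x (i₀ + j))) (proj₂ (x t))) (shifted j j≤l) (sym (+-suc i₀ j)) (proj₂ (forward (i₀ + j))))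
    (cong proj₂ (periodic (i₀ + m) (i₀ + 0) (trans ([m+n]%n≡m%n i₀ m) (cong (_% m) (sym (+-identityʳ i₀))))))
    where
    c : ℕ → ℕ
    c i = toℕ (proj₁ (x i))
    -- After this many steps the walk is at colour 0, where the labels are to be read from.
    i₀ : ℕ
    i₀ = m ∸ c 0
    colour : ∀ i → c i ≡ (c 0 + i) % m
    colour zero    = sym (trans (cong (_% m) (+-identityʳ (c 0))) (m<n⇒m%n≡m (toℕ<n (proj₁ (x 0)))))
    colour (suc i) = begin
      c (suc i)                  ≡⟨ proj₁ (forward i) ⟨
      suc (c i) % m              ≡⟨ cong (λ t → suc t % m) (colour i) ⟩
      suc ((c 0 + i) % m) % m    ≡⟨ [1+m%n]%n≡[1+m]%n (c 0 + i) l ⟩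
      suc (c 0 + i) % m          ≡⟨ cong (_% m) (+-suc (c 0) i) ⟨
      (c 0 + suc i) % m          ∎
      where open ≡-Reasoning
    shifted : ∀ j → j ≤ l → c (i₀ + j) ≡ j
    shifted j j≤l = begin
      c (i₀ + j)                 ≡⟨ colour (i₀ + j) ⟩
      (c 0 + (i₀ + j)) % m       ≡⟨ cong (_% m) (+-assoc (c 0) i₀ j) ⟨
      (c 0 + i₀ + j) % m         ≡⟨ cong (λ t → (t + j) % m) (m+[n∸m]≡n (<⇒≤ (toℕ<n (proj₁ (x 0))))) ⟩
      (m + j) % m                ≡⟨ cong (_% m) (+-comm m j) ⟩
      (j + m) % m                ≡⟨ [m+n]%n≡m%n j m ⟩
      j % m                      ≡⟨ m<n⇒m%n≡m (s≤s j≤l) ⟩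
      j                          ∎
      where open ≡-Reasoning

  -- The colours of a copy form a closed walk of m steps around the cycle of colours, so the copy
  -- runs forward throughout or backward throughout.
  G₀-free : Free (oddCycle k 1≤k) G₀
  G₀-free (f , inj , hom) = no-walk
    (closed⇒monotone {λ i → Forward (x i) (x (suc i))} {λ i → Forward (x (suc i)) (x i)}
      (λ i → G₀-Adj⁻ (unroll f i) (unroll f (suc i)) (unroll-Adj G₀ (s≤s 1<l) f hom i)) k (λ i → toℕ (proj₁ (x i)))
      (λ _ → proj₁) (λ _ → proj₁) (cong (toℕ ∘ proj₁) (periodic m 0 (n%n≡0 m))))
    where
    x : ℕ → Vertex
    x i = decode (unroll f i)
    periodic : ∀ i j → i % m ≡ j % m → x i ≡ x j
    periodic i j eq = cong decode (unroll-cong f i j eq)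
    reduce : ∀ i → x (i % m) ≡ x i
    reduce i = periodic (i % m) i (m%n%n≡m%n i m)
    reduce-suc : ∀ i → x (suc (i % m)) ≡ x (suc i)
    reduce-suc i = periodic (suc (i % m)) (suc i) ([1+m%n]%n≡[1+m]%n i l)
    -- A walk that always moves backwards is read backwards by taking steps of size l ≡ -1.
    wrap : ∀ i → suc (l * suc i) % m ≡ (l * i) % m
    wrap i = trans (cong (_% m) (lem l i)) ([m+n]%n≡m%n (l * i) m)
      where
      lem : ∀ l i → suc (l * suc i) ≡ l * i + suc l
      lem = solve-∀
    wrap-cong : ∀ i j → i % m ≡ j % m → (l * i) % m ≡ (l * j) % m
    wrap-cong i j eq = trans (%-distribˡ-* l i m) (trans (cong (λ t → (l % m * t) % m) eq) (sym (%-distribˡ-* l j m)))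
    no-walk : (∀ i → i < m → Forward (x i) (x (suc i))) ⊎ (∀ i → i < m → Forward (x (suc i)) (x i)) → ⊥
    no-walk (inj₁ fwd) = no-forward-walk x
      (λ i → subst₂ Forward (reduce i) (reduce-suc i) (fwd (i % m) (m%n<n i m))) periodic
    no-walk (inj₂ bwd) = no-forward-walk (λ i → x (l * i))
      (λ i → subst₂ Forward
        (trans (reduce-suc (l * suc i)) (periodic (suc (l * suc i)) (l * i) (wrap i)))
        (reduce (l * suc i)) (bwd ((l * suc i) % m) (m%n<n (l * suc i) m)))
      (λ i j eq → periodic (l * i) (l * j) (wrap-cong i j eq))

  -- Degrees and shattering in extensions of the constructed graph

  module _ (G : Graph (suc n′)) (G₀⊆G : ∀ u v → Adj G₀ u v → Adj G u v) where

    X-neighbours : ∀ v c → (∀ x → Adj G₀ v (encode (c , inj₁ x))) → suc N ≤ degree G v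
    X-neighbours v c v~X = ≤-trans
      (≤-reflexive (sym (trans (length-map X (allFin (suc N))) (length-tabulate id))))
      (Unique⇒length≤∣p∣ (neighbourhood G v)
        (Uniqueₚ.map⁺ {f = X} (λ {x} {y} eq → inj₁-injective (cong proj₂ (encode-injective (c , inj₁ x) (c , inj₁ y) eq))) (Uniqueₚ.allFin⁺ (suc N)))
        (Allₚ.map⁺ (All.tabulate λ {x} _ → ∈-neighbourhood⁺ G (G₀⊆G v (X x) (v~X x)))))
      where
      X : Fin (suc N) → Fin (suc n′)
      X x = encode (c , inj₁ x)

    degree-bound : ∀ v → suc N ≤ degree G v
    degree-bound v = by-label (decode v) refl
      where
      next : Fin m → Fin m
      next c = suc (toℕ c) mod m
      forward : ∀ c′ x → Forward (decode v) (c′ , inj₁ x) → Adj G₀ v (encode (c′ , inj₁ x))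
      forward c′ x h = G₀-Adj⁺ v (encode (c′ , inj₁ x)) (subst (Forward (decode v)) (sym (decode-encode (c′ , inj₁ x))) h)
      backward : ∀ c′ x → Forward (c′ , inj₁ x) (decode v) → Adj G₀ v (encode (c′ , inj₁ x))
      backward c′ x h = Adj-sym G₀ {encode (c′ , inj₁ x)} {v}
        (G₀-Adj⁺ (encode (c′ , inj₁ x)) v (subst (λ u → Forward u (decode v)) (sym (decode-encode (c′ , inj₁ x))) h))
      by-label : ∀ y → decode v ≡ y → suc N ≤ degree G v
      by-label (c , inj₂ y) eq = X-neighbours v (next c) λ x → forward (next c) x
        (subst (λ u → Forward u (next c , inj₁ x)) (sym eq) (sym (toℕ-fromℕ< _) , tt))
      -- The large class of colour 0 has no forward links, so its neighbours are found in the large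
      -- class of colour l.
      by-label (zero , inj₁ y) eq = X-neighbours v (l mod m) λ x → backward (l mod m) x
        (subst (Forward (l mod m , inj₁ x)) (sym eq)
          ( trans (cong (λ t → suc t % m) l%m) (n%n≡0 m)
          , λ l≡0 → l≢0 (trans (sym l%m) l≡0)))
        where
        l%m : toℕ (l mod m) ≡ l
        l%m = trans (toℕ-fromℕ< _) (m<n⇒m%n≡m ≤-refl)
      by-label (suc c , inj₁ y) eq = X-neighbours v (next (suc c)) λ x → forward (next (suc c)) x
        (subst (λ u → Forward u (next (suc c) , inj₁ x)) (sym eq) (sym (toℕ-fromℕ< _) , λ ()))

    minDegree-bound : suc N ≤ minDegree G
    minDegree-bound = v≤min⁺ {xs = map (degree G) (allFin (suc n′))} (degree-bound zero) (Allₚ.map⁺ (All.tabulate λ {v} _ → degree-bound v))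

    setPoint elementPoint : Core → Vertex
    setPoint     y = zero , inj₂ y
    elementPoint y = l mod m , inj₂ y

    -- Only the set matters at colour 0 and only the element at colour l; `zero` and `∅ᶜ` fill the
    -- other coordinate.
    setVertex : Fin (2 ^ suc d) → Fin (suc n′)
    setVertex A = encode (setPoint (A , zero))

    elementVertex : Fin (suc d) → Fin (suc n′)
    elementVertex s = encode (elementPoint (∅ᶜ , s))

    mod-toℕ : ∀ {j} → j ≤ l → toℕ (j mod m) ≡ j
    mod-toℕ j≤l = trans (toℕ-fromℕ< _) (m<n⇒m%n≡m (s≤s j≤l))

    ∈ᶜ⇒Adj : ∀ {A s} → s ∈ᶜ A → Adj G (setVertex A) (elementVertex s)
    ∈ᶜ⇒Adj {A} {s} s∈A = Adj-sym G {elementVertex s} {setVertex A} (G₀⊆G (elementVertex s) (setVertex A) (encode-Adj (elementPoint (∅ᶜ , s)) (setPoint (A , zero))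
      ( trans (cong (λ t → suc t % m) (mod-toℕ ≤-refl)) (n%n≡0 m)
      , (λ l≡0 → ⊥-elim (l≢0 (trans (sym (mod-toℕ ≤-refl)) l≡0)))
      , (λ _ ≢l → contradiction (mod-toℕ ≤-refl) ≢l)
      , λ _ → s∈A)))

    module _ (free : Free (oddCycle k 1≤k) G) where

      -- For s outside A the core contains a path of length 2k through all the colours between the
      -- two vertices, so an edge joining them would close a forbidden cycle.
      ∉ᶜ⇒¬Adj : ∀ {A s} → ¬ s ∈ᶜ A → ¬ Adj G (setVertex A) (elementVertex s)
      ∉ᶜ⇒¬Adj {A} {s} s∉A e = free (closedWalk⇒cycle {G = G} (s≤s (*-monoʳ-≤ 2 1≤k)) (length-applyUpTo path m)
        (Walk-applyUpTo path l λ j j<l → G₀⊆G (path j) (path (suc j)) (encode-Adj (point j) (point (suc j)) (colour-step j j<l , subst (λ c → Link c (inj₂ (label j)) (inj₂ (label (suc j)))) (sym (mod-toℕ (<⇒≤ j<l))) (link j j<l))))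
        (subst (λ t → Adj G (encode (elementPoint t)) (setVertex A)) (sym (label-≥2 1<l)) (Adj-sym G {setVertex A} {elementVertex s} e))
        (Uniqueₚ.applyUpTo⁺₁ path m λ {i} {j} i<j j<m eq → <⇒≢ i<j
          (trans (sym (mod-toℕ (s≤s⁻¹ (<-trans i<j j<m)))) (trans (cong (toℕ ∘ proj₁) (encode-injective (point i) (point j) eq)) (mod-toℕ (s≤s⁻¹ j<m))))))
        where
        label : ℕ → Core
        label 0             = A , zero
        label 1             = A , s
        label (suc (suc _)) = ∅ᶜ , s
        label-≥2 : ∀ {j} → 1 < j → label j ≡ (∅ᶜ , s)
        label-≥2 (s≤s (s≤s _)) = refl
        point : ℕ → Vertex
        point j = j mod m , inj₂ (label j)
        path : ℕ → Fin (suc n′)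
        path j = encode (point j)
        colour-step : ∀ j → j < l → suc (toℕ (j mod m)) % m ≡ toℕ (suc j mod m)
        colour-step j j<l = trans (cong (λ t → suc t % m) (mod-toℕ (<⇒≤ j<l))) (sym (toℕ-fromℕ< _))
        link : ∀ j → j < l → Link j (inj₂ (label j)) (inj₂ (label (suc j)))
        link 0             j<l = (λ _ → refl , s∉A) , (λ 0≢0 → contradiction refl 0≢0) , λ 0≡l → contradiction (sym 0≡l) l≢0
        link 1             j<l = (λ ()) , (λ _ _ → refl) , λ 1≡l → contradiction 1≡l (<⇒≢ j<l)
        link (suc (suc j)) j<l = (λ ()) , (λ _ _ → refl) , λ j≡l → contradiction j≡l (<⇒≢ j<l)

      elementSet : Subset (suc n′)
      elementSet = Vec.tabulate λ v → does (any? λ s → v Finₚ.≟ elementVertex s)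

      ∈-elementSet⁺ : ∀ s → elementVertex s ∈ elementSet
      ∈-elementSet⁺ s = lookup⇒[]= (elementVertex s) elementSet
        (trans (lookup∘tabulate (λ v → does (any? λ s → v Finₚ.≟ elementVertex s)) (elementVertex s))
          (dec-true (any? λ t → elementVertex s Finₚ.≟ elementVertex t) (s , refl)))

      ∈-elementSet⁻ : ∀ {v} → v ∈ elementSet → ∃ λ s → v ≡ elementVertex s
      ∈-elementSet⁻ {v} v∈ = does⇒ (any? λ s → v Finₚ.≟ elementVertex s)
        (Equivalence.from T-≡ (trans (sym (lookup∘tabulate (λ v → does (any? λ s → v Finₚ.≟ elementVertex s)) v)) ([]=⇒lookup v∈)))

      elementSet-size : suc d ≤ ∣ elementSet ∣
      elementSet-size = ≤-trans
        (≤-reflexive (sym (trans (length-map elementVertex (allFin (suc d))) (length-tabulate id))))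
        (Unique⇒length≤∣p∣ elementSet
          (Uniqueₚ.map⁺ {f = elementVertex} (λ {s} {t} eq → cong proj₂ (inj₂-injective (cong proj₂
            (encode-injective (elementPoint (∅ᶜ , s)) (elementPoint (∅ᶜ , t)) eq)))) (Uniqueₚ.allFin⁺ (suc d)))
          (Allₚ.map⁺ (All.tabulate λ {s} _ → ∈-elementSet⁺ s)))

      elementSet-shattered : Shattered G elementSet
      elementSet-shattered A A⊆ = setVertex code , ⊆-antisym trace⊆A A⊆trace
        where
        bit : Fin (suc d) → Fin 2
        bit s = if does (elementVertex s ∈? A) then suc zero else zero
        code : Fin (2 ^ suc d)
        code = funToFin bit
        code⁺ : ∀ {s} → elementVertex s ∈ A → s ∈ᶜ code
        code⁺ {s} s∈A = trans (finToFun-funToFin bit s) (cong (if_then suc zero else zero) (dec-true (elementVertex s ∈? A) s∈A))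
        code⁻ : ∀ {s} → elementVertex s ∉ A → ¬ s ∈ᶜ code
        code⁻ {s} s∉A s∈ = contradiction (trans (sym s∈) (trans (finToFun-funToFin bit s) (cong (if_then suc zero else zero) (dec-false (elementVertex s ∈? A) s∉A)))) λ ()
        trace⊆A : neighbourhood G (setVertex code) ∩ elementSet Sub.⊆ A
        trace⊆A {v} v∈ with x∈p∩q⁻ (neighbourhood G (setVertex code)) elementSet v∈
        ... | v∈N , v∈E with ∈-elementSet⁻ v∈E
        ...   | s , refl with elementVertex s ∈? A
        ...     | yes s∈A = s∈A
        ...     | no  s∉A = contradiction (∈-neighbourhood⁻ G v∈N) (∉ᶜ⇒¬Adj (code⁻ s∉A))
        A⊆trace : A Sub.⊆ neighbourhood G (setVertex code) ∩ elementSet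
        A⊆trace {v} v∈A with ∈-elementSet⁻ (A⊆ v∈A)
        ... | s , refl = x∈p∩q⁺ (∈-neighbourhood⁺ G (∈ᶜ⇒Adj (code⁺ v∈A)) , A⊆ v∈A)

-- The computed VC-dimension

∈-allSubsets : ∀ {n} (p : Subset n) → p LM.∈ allSubsets n
∈-allSubsets Vec.[]            = here refl
∈-allSubsets (true  Vec.∷ p) = ∈-++⁺ˡ (∈-map⁺ (inside Vec.∷_) (∈-allSubsets p))
∈-allSubsets (false Vec.∷ p) = ∈-++⁺ʳ (map (inside Vec.∷_) (allSubsets _)) (∈-map⁺ (outside Vec.∷_) (∈-allSubsets p))

Shattered⇒∣S∣≤vcDim : ∀ {n} (G : Graph n) {S} → Shattered G S → ∣ S ∣ ≤ vcDim G
Shattered⇒∣S∣≤vcDim {n} G {S} sh = v≤max⁺ 0 (map ∣_∣ (filter (shattered? G) (allSubsets n)))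
  (inj₂ (LM.lose (∈-map⁺ ∣_∣ (∈-filter⁺ (shattered? G) (∈-allSubsets S) sh)) ≤-refl))

vcDim≤ : ∀ {n} (G : Graph n) {C} → (∀ S → Shattered G S → ∣ S ∣ ≤ C) → vcDim G ≤ C
vcDim≤ {n} G bound = max≤v⁺ z≤n (Allₚ.map⁺ (All.map (bound _) (Allₚ.all-filter (shattered? G) (allSubsets n))))

-- Maximal extensions

addEdge-mono : ∀ {n} {G G′ : Graph n} {x y} (x≢y : x ≢ y) → (∀ u v → Adj G u v → Adj G′ u v) →
  ∀ u v → Adj (addEdge G x y x≢y) u v → Adj (addEdge G′ x y x≢y) u v
addEdge-mono {G = G} {G′} x≢y G⊆G′ u v e with Equivalence.to (T-∨ {adj G u v}) e
... | inj₁ old = Equivalence.from (T-∨ {adj G′ u v}) (inj₁ (G⊆G′ u v old))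
... | inj₂ new = Equivalence.from (T-∨ {adj G′ u v}) (inj₂ new)

addEdge-new : ∀ {n} (G : Graph n) {x y} (x≢y : x ≢ y) → Adj (addEdge G x y x≢y) x y
addEdge-new G {x} {y} x≢y = Equivalence.from (T-∨ {adj G x y}) (inj₂
  (Equivalence.from (T-∨ {does (x Finₚ.≟ x) ∧ does (y Finₚ.≟ y)})
    (inj₁ (Equivalence.from (T-∧ {does (x Finₚ.≟ x)}) (⇒does (x Finₚ.≟ x) refl , ⇒does (y Finₚ.≟ y) refl)))))

module _ {m n : ℕ} (H : Graph m) where

  Saturated : Graph n → Fin n × Fin n → Set
  Saturated G (x , y) = (x≢y : x ≢ y) → ¬ Adj G x y → Contains H (addEdge G x y x≢y)

  -- Each pair is treated once: either adding it creates a copy of H, which persists in every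
  -- extension, or the edge is added. The case split is classical, hence the double negation; it
  -- suffices for refuting `BoundsVC`.
  saturate : ∀ ps (G : Graph n) → Free H G →
    ¬ ¬ (∃ λ G′ → (∀ u v → Adj G u v → Adj G′ u v) × Free H G′ × All (Saturated G′) ps)
  saturate []             G free none = none (G , (λ _ _ e → e) , free , [])
  saturate ((x , y) ∷ ps) G free none with x Finₚ.≟ y
  ... | yes x≡y = saturate ps G free λ (G′ , ext , free′ , sat) →
    none (G′ , ext , free′ , (λ x≢y → contradiction x≡y x≢y) ∷ sat)
  ... | no x≢y = ¬¬-excluded-middle {A = Contains H (addEdge G x y x≢y)} λ
    { (yes (f , inj , hom)) → saturate ps G free λ (G′ , ext , free′ , sat) →
        none (G′ , ext , free′
          , (λ x≢y′ _ → f , inj , λ u v e → addEdge-mono {G = G} {G′} x≢y′ ext (f u) (f v) (hom u v e)) ∷ sat)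
    ; (no free₁) → saturate ps (addEdge G x y x≢y) free₁ λ (G′ , ext , free′ , sat) →
        none (G′ , (λ u v e → ext u v (Equivalence.from (T-∨ {adj G u v}) (inj₁ e))) , free′
          , (λ _ x≁y → contradiction (ext x y (addEdge-new G x≢y)) x≁y) ∷ sat) }

  maximalExtension : (G : Graph n) → Free H G →
    ¬ ¬ (∃ λ G′ → (∀ u v → Adj G u v → Adj G′ u v) × MaximalFree H G′)
  maximalExtension G free none = saturate (cartesianProduct (allFin n) (allFin n)) G free
    λ (G′ , ext , free′ , sat) → none (G′ , ext , free′ , λ x y →
      All.lookup sat (∈-cartesianProduct⁺ (∈-allFin x) (∈-allFin y)))

sparse-graph-of-large-vcDim : ∀ k (1≤k : 1 ≤ k) d N →
  ¬ ¬ (∃ λ n → suc n ≡ suc (2 * k) * (suc N + 2 ^ suc d * suc d) ×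
    Σ (Graph (suc n)) λ G → MaximalFree (oddCycle k 1≤k) G × suc N ≤ minDegree G × d < vcDim G)
sparse-graph-of-large-vcDim k 1≤k d N none =
  maximalExtension (oddCycle k 1≤k) G₀ G₀-free λ (G , ext , maximal) → none
    ( n′ , refl , G , maximal , minDegree-bound G ext
    , ≤-trans (elementSet-size G ext (proj₁ maximal)) (Shattered⇒∣S∣≤vcDim G (elementSet-shattered G ext (proj₁ maximal))))
  where open LowerBound k 1≤k d N

-- Rational arithmetic and the threshold

open import Data.Integer.Base as ℤ using (+_; -[1+_])
open ℝ

module _ (r : ℚ) (i : ℤ.ℤ) (d : ℕ) where

  ≤-/⁺ : ↥ r ℤ.* + suc d ℤ.≤ i ℤ.* ↧ r → r ℚ.≤ i / suc d
  ≤-/⁺ h = ℚₚ.toℚᵘ-cancel-≤ (ℚᵘₚ.≤-respʳ-≃ (ℚᵘₚ.≃-sym (ℚₚ.toℚᵘ-fromℚᵘ (ℚᵘ.mkℚᵘ i d))) (unreduced r h))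
    where
    unreduced : ∀ r → ↥ r ℤ.* + suc d ℤ.≤ i ℤ.* ↧ r → toℚᵘ r ℚᵘ.≤ ℚᵘ.mkℚᵘ i d
    unreduced record{} h = ℚᵘ.*≤* h

  ≤-/⁻ : r ℚ.≤ i / suc d → ↥ r ℤ.* + suc d ℤ.≤ i ℤ.* ↧ r
  ≤-/⁻ h = unreduced r (ℚᵘₚ.≤-respʳ-≃ (ℚₚ.toℚᵘ-fromℚᵘ (ℚᵘ.mkℚᵘ i d)) (ℚₚ.toℚᵘ-mono-≤ h))
    where
    unreduced : ∀ r → toℚᵘ r ℚᵘ.≤ ℚᵘ.mkℚᵘ i d → ↥ r ℤ.* + suc d ℤ.≤ i ℤ.* ↧ r
    unreduced record{} (ℚᵘ.*≤* h) = h

  <-/⁻ : r ℚ.< i / suc d → ↥ r ℤ.* + suc d ℤ.< i ℤ.* ↧ r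
  <-/⁻ h = unreduced r (ℚᵘₚ.<-respʳ-≃ (ℚₚ.toℚᵘ-fromℚᵘ (ℚᵘ.mkℚᵘ i d)) (ℚₚ.toℚᵘ-mono-< h))
    where
    unreduced : ∀ r → toℚᵘ r ℚᵘ.< ℚᵘ.mkℚᵘ i d → ↥ r ℤ.* + suc d ℤ.< i ℤ.* ↧ r
    unreduced record{} (ℚᵘ.*<* h) = h

  /-<⁻ : i / suc d ℚ.< r → i ℤ.* ↧ r ℤ.< ↥ r ℤ.* + suc d
  /-<⁻ h = unreduced r (ℚᵘₚ.<-respˡ-≃ (ℚₚ.toℚᵘ-fromℚᵘ (ℚᵘ.mkℚᵘ i d)) (ℚₚ.toℚᵘ-mono-< h))
    where
    unreduced : ∀ r → ℚᵘ.mkℚᵘ i d ℚᵘ.< toℚᵘ r → i ℤ.* ↧ r ℤ.< ↥ r ℤ.* + suc d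
    unreduced record{} (ℚᵘ.*<* h) = h

minDegree≤degree : ∀ {n} (G : Graph (suc n)) v → minDegree G ≤ degree G v
minDegree≤degree {n} G v = All.lookup (min≤xs (degree G _) (map (degree G) (allFin (suc n)))) (∈-map⁺ (degree G) (∈-allFin v))

-- For γ = g / b above 1 / m, integrality gives b + 1 ≤ g m, so every degree is at least (1 + 1/b) n
-- / m: the hypothesis of `UpperBound` with e = b.
above-threshold-bounds : ∀ k (1≤k : 1 ≤ k) γ → + 1 / (1 + 2 * k) ℚ.< γ → BoundsVC (oddCycle k 1≤k) (fromℚ γ)
above-threshold-bounds k 1≤k γ@(mkℚ -[1+ _ ] _ _) 1/m<γ = contradiction (/-<⁻ γ (+ 1) (2 * k) 1/m<γ) λ ()
above-threshold-bounds k 1≤k γ@(mkℚ (+ g) b′ _) 1/m<γ =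
  (λ q q<0 → ℚₚ.<-≤-trans q<0 (ℚₚ.nonNegative⁻¹ γ)) , order-bound + suc D , λ n G maximal γ≤ →
    vcDim≤ G (shattered-bound G maximal λ v → begin
      suc b * suc n                  ≤⟨ *-monoˡ-≤ (suc n) b<gm ⟩
      g * m * suc n                  ≡⟨ lem₁ g m (suc n) ⟩
      g * suc n * m                  ≤⟨ *-monoˡ-≤ m (gn≤δb n (minDegree G) (γ≤⇒ (+ minDegree G / suc n) γ≤)) ⟩
      minDegree G * b * m            ≤⟨ *-monoˡ-≤ m (*-monoˡ-≤ b (minDegree≤degree G v)) ⟩
      degree G v * b * m             ≡⟨ lem₂ (degree G v) b m ⟩
      b * m * degree G v             ∎)
  where
  b : ℕ
  b = suc b′
  open UpperBound k 1≤k b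
  open ≤-Reasoning
  lem₁ : ∀ g m n → g * m * n ≡ g * n * m
  lem₁ = solve-∀
  lem₂ : ∀ δ b m → δ * b * m ≡ b * m * δ
  lem₂ = solve-∀
  b<gm : b < g * m
  b<gm = ℤₚ.drop‿+<+ (subst₂ ℤ._<_ (ℤₚ.*-identityˡ (+ b)) (sym (ℤₚ.pos-* g m)) (/-<⁻ γ (+ 1) (2 * k) 1/m<γ))
  γ≤⇒ : ∀ p → fromℚ γ ≤ᴿ fromℚ p → γ ℚ.≤ p
  γ≤⇒ p γ≤p = ℚₚ.≮⇒≥ λ p<γ → ℚₚ.<-irrefl refl (γ≤p p p<γ)
  gn≤δb : ∀ n δ → γ ℚ.≤ + δ / suc n → g * suc n ≤ δ * b
  gn≤δb n δ γ≤ = ℤₚ.drop‿+≤+ (subst₂ ℤ._≤_ (sym (ℤₚ.pos-* g (suc n))) (sym (ℤₚ.pos-* δ b)) (≤-/⁻ γ (+ δ) n γ≤))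

-- For r = a / b with a ≥ 0, the inequality r < 1 / m leaves a slack b - a m of at least 1. This
-- contributes N, which exceeds the cost a m Q of the core.
density-below : ∀ l Q r → r ℚ.< + 1 / suc l → ∀ {δ} → let N = suc (ℤ.∣ ↥ r ∣ * suc l * Q) in N ≤ δ →
  ↥ r ℤ.* + (suc l * (N + Q)) ℤ.≤ + δ ℤ.* ↧ r
density-below l Q (mkℚ -[1+ a ] b′ _) _ {δ} _ = ℤₚ.≤-trans ℤ.-≤+ (ℤₚ.≤-reflexive (ℤₚ.pos-* δ (suc b′)))
density-below l Q r@(mkℚ (+ a) b′ _) r<1/m {δ} N≤δ =
  subst₂ ℤ._≤_ (ℤₚ.pos-* a (m * (N + Q))) (ℤₚ.pos-* δ b) (ℤ.+≤+ (begin
    a * (m * (N + Q))        ≡⟨ lem₁ a m N Q ⟩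
    a * m * N + a * m * Q    ≤⟨ +-monoʳ-≤ (a * m * N) (n≤1+n (a * m * Q)) ⟩
    a * m * N + N            ≡⟨ lem₂ (a * m) N ⟩
    N * suc (a * m)          ≤⟨ *-mono-≤ N≤δ am<b ⟩
    δ * b                    ∎))
  where
  open ≤-Reasoning
  b m N : ℕ
  b = suc b′
  m = suc l
  N = suc (a * m * Q)
  lem₁ : ∀ a m N Q → a * (m * (N + Q)) ≡ a * m * N + a * m * Q
  lem₁ = solve-∀
  lem₂ : ∀ x N → x * N + N ≡ N * suc x
  lem₂ = solve-∀
  am<b : a * m < b
  am<b = ℤₚ.drop‿+<+ (subst₂ ℤ._<_ (sym (ℤₚ.pos-* a m)) (ℤₚ.*-identityˡ (+ b)) (<-/⁻ r (+ 1) l r<1/m))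

L<U : ∀ (y : ℝ) {p r} → L y p → U y r → p ℚ.< r
L<U y {p} {r} p<y y<r with p ℚₚ.<? r
... | yes p<r = p<r
... | no  p≮r = contradiction (p<y , y<p) (disjoint y p)
  where
  y<p : U y p
  y<p = let (s , s<r , y<s) = Equivalence.to (U-rounded y r) y<r
        in Equivalence.from (U-rounded y p) (s , ℚₚ.<-≤-trans s<r (ℚₚ.≮⇒≥ p≮r) , y<s)

below-threshold-unbounded : ∀ k (1≤k : 1 ≤ k) (y : ℝ) r → U y r → r ℚ.< + 1 / (1 + 2 * k) → ¬ BoundsVC (oddCycle k 1≤k) y
below-threshold-unbounded k 1≤k y r y<r r<1/m (_ , C , bound) =
  sparse-graph-of-large-vcDim k 1≤k C (ℤ.∣ ↥ r ∣ * suc (2 * k) * Q) λ (n , n≡ , G , maximal , δ-large , vc-large) →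
    <⇒≱ vc-large (bound n G maximal λ p p<y → ℚₚ.<-≤-trans (L<U y p<y y<r) (≤-/⁺ r (+ minDegree G) n
      (subst (λ t → ↥ r ℤ.* + t ℤ.≤ + minDegree G ℤ.* ↧ r) (sym n≡) (density-below (2 * k) Q r r<1/m δ-large))))
  where
  Q : ℕ
  Q = 2 ^ suc C * suc C

mainTheorem5 : (k : ℕ) (1≤k : 1 ≤ k) → IsVCThreshold (oddCycle k 1≤k) (fromℚ (+ 1 / (1 + 2 * k)))
mainTheorem5 k 1≤k = lower , greatest
  where
  lower : ∀ y → BoundsVC (oddCycle k 1≤k) y → fromℚ (+ 1 / (1 + 2 * k)) ≤ᴿ y
  lower y bounds p p<1/m =
    let (r , p<r , r<1/m) = ℚₚ.<-dense p<1/m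
    -- Locatedness at p < r gives p < y, as wanted, or y < r, which contradicts unboundedness below
    -- 1 / m.
    in [ id , (λ y<r → contradiction bounds (below-threshold-unbounded k 1≤k y r y<r r<1/m)) ]′ (located y p r p<r)

  greatest : ∀ z → (∀ y → BoundsVC (oddCycle k 1≤k) y → z ≤ᴿ y) → z ≤ᴿ fromℚ (+ 1 / (1 + 2 * k))
  greatest z z≤ p p<z =
    let (r , p<r , r<z) = Equivalence.to (L-rounded z p) p<z
    -- If 1 / m were below r, a rational γ between them would be admissible, so z would be at most
    -- γ, against γ < r < z.
    in ℚₚ.<-≤-trans p<r (ℚₚ.≮⇒≥ λ 1/m<r →
      let (γ , 1/m<γ , γ<r) = ℚₚ.<-dense 1/m<r
      in ℚₚ.<-asym γ<r (z≤ (fromℚ γ) (above-threshold-bounds k 1≤k γ 1/m<γ) r r<z))
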